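{- There is a universal constant $c_0>0$ such that for every integer $k\ge 2$ and every $\varepsilon\in(0,1)$ there exists a finite dataset $P\subset\mathbb{R}$ such that every $\varepsilon$-coreset $S$ of $P$ for $k$-Median in $\mathbb{R}$ has size $|S|\ge c_0\,k\,\varepsilon^{ -1}$ (i.e. $|S|\ge\Omega(k\varepsilon^{ -1})$).
   Context: For a finite $P\subset\mathbb{R}$ and a set $C\subset\mathbb{R}$ of $k$ centers, the $k$-Median cost is $\mathrm{cost}(P,C)=\sum_{p\in P}\min_{c\in C}|p-c|$. An $\varepsilon$-coreset of $P$ for $k$-Median is a subset $S\subseteq P$ with a weight function $w:S\to\mathbb{R}_{\ge 0}$ such that for every $C\subset\mathbb{R}$ with $|C|=k$, $$(1-\varepsilon)\,\mathrm{cost}(P,C)\le\sum_{p\in S}w(p)\min_{c\in C}|p-c|\le(1+\varepsilon)\,\mathrm{cost}(P,C).$$ Its size is $|S|$. -}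

module Defs where

open import Data.Integer.Base using (+_)
open import Data.Nat.Base as ℕ using (ℕ; zero; suc)
import Data.Nat.Properties as ℕ
open import Data.Product.Base using (Σ-syntax; ∃-syntax; _×_; _,_; proj₁; proj₂)
open import Data.Rational.Base as ℚ using (ℚ; 0ℚ; 1ℚ; ½)
import Data.Rational.Properties as ℚ
open import Data.Rational.Solver using (module +-*-Solver)
open import Data.Sum.Base using (inj₁; inj₂)
open import Data.Vec.Functional using (Vector; head; tail; foldr)
open import Function.Definitions using (Injective)
open import Relation.Binary.PropositionalEquality
  using (_≡_; refl; sym; trans; cong; cong₂; subst)

------------------------------------------------------------------------
-- Real numbers, as Cauchy sequences of rationals.  All operations act
-- termwise, so ring identities hold because they hold termwise in ℚ.

Cauchy : (ℕ → ℚ) → Set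
Cauchy x = ∀ δ → 0ℚ ℚ.< δ →
  ∃[ N ] ∀ m n → N ℕ.≤ m → N ℕ.≤ n → ℚ.∣ x m ℚ.- x n ∣ ℚ.≤ δ

record ℝ : Set where
  constructor mkℝ
  field
    seq    : ℕ → ℚ
    cauchy : Cauchy seq

open ℝ public

infix 4 _≃_ _≤_ _<_

_≃_ : ℝ → ℝ → Set
x ≃ y = ∀ δ → 0ℚ ℚ.< δ →
  ∃[ N ] ∀ n → N ℕ.≤ n → ℚ.∣ seq x n ℚ.- seq y n ∣ ℚ.≤ δ

_≤_ : ℝ → ℝ → Set
x ≤ y = ∀ δ → 0ℚ ℚ.< δ →
  ∃[ N ] ∀ n → N ℕ.≤ n → seq x n ℚ.≤ seq y n ℚ.+ δ

_<_ : ℝ → ℝ → Set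
x < y = ∃[ δ ] 0ℚ ℚ.< δ ×
  (∃[ N ] ∀ n → N ℕ.≤ n → seq x n ℚ.+ δ ℚ.≤ seq y n)

open ℚ.≤-Reasoning
open +-*-Solver using (solve; _:=_; _:+_; _:*_; _:-_; :-_; con)

private abstract
  half-pos : ∀ {δ} → 0ℚ ℚ.< δ → 0ℚ ℚ.< ½ ℚ.* δ
  half-pos {δ} δ>0 = subst (ℚ._< ½ ℚ.* δ) (ℚ.*-zeroʳ ½) (ℚ.*-monoʳ-<-pos ½ δ>0)

  half+half : ∀ δ → ½ ℚ.* δ ℚ.+ ½ ℚ.* δ ≡ δ
  half+half = solve 1 (λ d → con ½ :* d :+ con ½ :* d := d) refl

  *-pos : ∀ {p q} → 0ℚ ℚ.< p → 0ℚ ℚ.< q → 0ℚ ℚ.< p ℚ.* q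
  *-pos {p} {q} p>0 q>0 =
    subst (ℚ._< p ℚ.* q) (ℚ.*-zeroʳ p)
      (ℚ.*-monoʳ-<-pos p {{ℚ.positive p>0}} q>0)

  *-mono : ∀ {p q r s} → 0ℚ ℚ.≤ r → 0ℚ ℚ.≤ q → p ℚ.≤ q → r ℚ.≤ s →
           p ℚ.* r ℚ.≤ q ℚ.* s
  *-mono {p} {q} {r} {s} r≥0 q≥0 p≤q r≤s = begin
    p ℚ.* r  ≤⟨ ℚ.*-monoʳ-≤-nonNeg r {{ℚ.nonNegative r≥0}} p≤q ⟩
    q ℚ.* r  ≤⟨ ℚ.*-monoˡ-≤-nonNeg q {{ℚ.nonNegative q≥0}} r≤s ⟩
    q ℚ.* s  ∎

  ∣-∣-lub : ∀ {p q} → p ℚ.≤ q → ℚ.- p ℚ.≤ q → ℚ.∣ p ∣ ℚ.≤ q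
  ∣-∣-lub {p} p≤q -p≤q with ℚ.∣p∣≡p∨∣p∣≡-p p
  ... | inj₁ eq = ℚ.≤-trans (ℚ.≤-reflexive eq) p≤q
  ... | inj₂ eq = ℚ.≤-trans (ℚ.≤-reflexive eq) -p≤q

  p≤∣p∣ : ∀ p → p ℚ.≤ ℚ.∣ p ∣
  p≤∣p∣ p with ℚ.≤-total 0ℚ p
  ... | inj₁ 0≤p = ℚ.≤-reflexive (sym (ℚ.0≤p⇒∣p∣≡p 0≤p))
  ... | inj₂ p≤0 = ℚ.≤-trans p≤0 (ℚ.0≤∣p∣ p)

  ∣a-b∣-sym : ∀ a b → ℚ.∣ a ℚ.- b ∣ ≡ ℚ.∣ b ℚ.- a ∣
  ∣a-b∣-sym a b = trans (sym (ℚ.∣-p∣≡∣p∣ (a ℚ.- b)))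
    (cong ℚ.∣_∣ (solve 2 (λ a b → :- (a :- b) := b :- a) refl a b))

  a≤∣a-b∣+b : ∀ a b → a ℚ.≤ ℚ.∣ a ℚ.- b ∣ ℚ.+ b
  a≤∣a-b∣+b a b = begin
    a                      ≡⟨ solve 2 (λ a b → a := (a :- b) :+ b) refl a b ⟩
    (a ℚ.- b) ℚ.+ b        ≤⟨ ℚ.+-monoˡ-≤ b (p≤∣p∣ (a ℚ.- b)) ⟩
    ℚ.∣ a ℚ.- b ∣ ℚ.+ b    ∎

  a≤b+δ : ∀ {a b δ} → ℚ.∣ a ℚ.- b ∣ ℚ.≤ δ → a ℚ.≤ δ ℚ.+ b
  a≤b+δ {a} {b} h = ℚ.≤-trans (a≤∣a-b∣+b a b) (ℚ.+-monoˡ-≤ b h)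

  b≤a+δ : ∀ {a b δ} → ℚ.∣ a ℚ.- b ∣ ℚ.≤ δ → b ℚ.≤ δ ℚ.+ a
  b≤a+δ {a} {b} {δ} h = a≤b+δ (subst (ℚ._≤ δ) (∣a-b∣-sym a b) h)

  a-b≤δ : ∀ {a b δ} → a ℚ.≤ δ ℚ.+ b → a ℚ.- b ℚ.≤ δ
  a-b≤δ {a} {b} {δ} h = begin
    a ℚ.- b            ≤⟨ ℚ.+-monoˡ-≤ (ℚ.- b) h ⟩
    δ ℚ.+ b ℚ.- b      ≡⟨ solve 2 (λ d b → d :+ b :- b := d) refl δ b ⟩
    δ                  ∎

  close : ∀ {a b δ} → a ℚ.≤ δ ℚ.+ b → b ℚ.≤ δ ℚ.+ a → ℚ.∣ a ℚ.- b ∣ ℚ.≤ δ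
  close {a} {b} {δ} a≤ b≤ = ∣-∣-lub (a-b≤δ a≤)
    (subst (ℚ._≤ δ) (solve 2 (λ a b → b :- a := :- (a :- b)) refl a b) (a-b≤δ b≤))

  -- A termwise operation f preserves Cauchy sequences as soon as it is
  -- nonexpansive in each variable.
  lift₂-cauchy : (f : ℚ → ℚ → ℚ) →
    (∀ a b c d {δ₁ δ₂} → ℚ.∣ a ℚ.- c ∣ ℚ.≤ δ₁ → ℚ.∣ b ℚ.- d ∣ ℚ.≤ δ₂ →
       ℚ.∣ f a b ℚ.- f c d ∣ ℚ.≤ δ₁ ℚ.+ δ₂) →
    ∀ {x y} → Cauchy x → Cauchy y → Cauchy (λ n → f (x n) (y n))
  lift₂-cauchy f nonexp {x} {y} cx cy δ δ>0
    with cx (½ ℚ.* δ) (half-pos δ>0) | cy (½ ℚ.* δ) (half-pos δ>0)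
  ... | N , hx | M , hy = N ℕ.⊔ M , λ m n m≥ n≥ → begin
    ℚ.∣ f (x m) (y m) ℚ.- f (x n) (y n) ∣
      ≤⟨ nonexp (x m) (y m) (x n) (y n)
           (hx m n (ℕ.m⊔n≤o⇒m≤o N M m≥) (ℕ.m⊔n≤o⇒m≤o N M n≥))
           (hy m n (ℕ.m⊔n≤o⇒n≤o N M m≥) (ℕ.m⊔n≤o⇒n≤o N M n≥)) ⟩
    ½ ℚ.* δ ℚ.+ ½ ℚ.* δ  ≡⟨ half+half δ ⟩
    δ                    ∎

  +-nonexp : ∀ a b c d {δ₁ δ₂} → ℚ.∣ a ℚ.- c ∣ ℚ.≤ δ₁ → ℚ.∣ b ℚ.- d ∣ ℚ.≤ δ₂ →
    ℚ.∣ (a ℚ.+ b) ℚ.- (c ℚ.+ d) ∣ ℚ.≤ δ₁ ℚ.+ δ₂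
  +-nonexp a b c d {δ₁} {δ₂} h₁ h₂ = begin
    ℚ.∣ (a ℚ.+ b) ℚ.- (c ℚ.+ d) ∣
      ≡⟨ cong ℚ.∣_∣ (solve 4 (λ a b c d →
           (a :+ b) :- (c :+ d) := (a :- c) :+ (b :- d)) refl a b c d) ⟩
    ℚ.∣ (a ℚ.- c) ℚ.+ (b ℚ.- d) ∣      ≤⟨ ℚ.∣p+q∣≤∣p∣+∣q∣ (a ℚ.- c) (b ℚ.- d) ⟩
    ℚ.∣ a ℚ.- c ∣ ℚ.+ ℚ.∣ b ℚ.- d ∣    ≤⟨ ℚ.+-mono-≤ h₁ h₂ ⟩
    δ₁ ℚ.+ δ₂                          ∎

  ⊓-half : ∀ a b c d {δ₁ δ₂} → ℚ.∣ a ℚ.- c ∣ ℚ.≤ δ₁ → ℚ.∣ b ℚ.- d ∣ ℚ.≤ δ₂ →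
    a ℚ.⊓ b ℚ.≤ (δ₁ ℚ.+ δ₂) ℚ.+ c ℚ.⊓ d
  ⊓-half a b c d {δ₁} {δ₂} h₁ h₂ with ℚ.⊓-sel c d
  ... | inj₁ eq rewrite eq = begin
    a ℚ.⊓ b              ≤⟨ ℚ.p⊓q≤p a b ⟩
    a                    ≤⟨ a≤b+δ h₁ ⟩
    δ₁ ℚ.+ c             ≡⟨ solve 2 (λ e c → e :+ c := (e :+ con 0ℚ) :+ c) refl δ₁ c ⟩
    (δ₁ ℚ.+ 0ℚ) ℚ.+ c    ≤⟨ ℚ.+-monoˡ-≤ c (ℚ.+-monoʳ-≤ δ₁ (ℚ.≤-trans (ℚ.0≤∣p∣ (b ℚ.- d)) h₂)) ⟩
    (δ₁ ℚ.+ δ₂) ℚ.+ c    ∎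
  ... | inj₂ eq rewrite eq = begin
    a ℚ.⊓ b              ≤⟨ ℚ.p⊓q≤q a b ⟩
    b                    ≤⟨ a≤b+δ h₂ ⟩
    δ₂ ℚ.+ d             ≡⟨ solve 2 (λ e c → e :+ c := (con 0ℚ :+ e) :+ c) refl δ₂ d ⟩
    (0ℚ ℚ.+ δ₂) ℚ.+ d    ≤⟨ ℚ.+-monoˡ-≤ d (ℚ.+-monoˡ-≤ δ₂ (ℚ.≤-trans (ℚ.0≤∣p∣ (a ℚ.- c)) h₁)) ⟩
    (δ₁ ℚ.+ δ₂) ℚ.+ d    ∎

  ⊓-nonexp : ∀ a b c d {δ₁ δ₂} → ℚ.∣ a ℚ.- c ∣ ℚ.≤ δ₁ → ℚ.∣ b ℚ.- d ∣ ℚ.≤ δ₂ →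
    ℚ.∣ (a ℚ.⊓ b) ℚ.- (c ℚ.⊓ d) ∣ ℚ.≤ δ₁ ℚ.+ δ₂
  ⊓-nonexp a b c d {δ₁} {δ₂} h₁ h₂ = close (⊓-half a b c d h₁ h₂)
    (⊓-half c d a b (subst (ℚ._≤ δ₁) (∣a-b∣-sym a c) h₁)
                    (subst (ℚ._≤ δ₂) (∣a-b∣-sym b d) h₂))

  ∣-∣-half : ∀ a b {δ} → ℚ.∣ a ℚ.- b ∣ ℚ.≤ δ → ℚ.∣ a ∣ ℚ.≤ δ ℚ.+ ℚ.∣ b ∣
  ∣-∣-half a b {δ} h = begin
    ℚ.∣ a ∣                       ≡⟨ cong ℚ.∣_∣ (solve 2 (λ a b → a := (a :- b) :+ b) refl a b) ⟩
    ℚ.∣ (a ℚ.- b) ℚ.+ b ∣         ≤⟨ ℚ.∣p+q∣≤∣p∣+∣q∣ (a ℚ.- b) b ⟩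
    ℚ.∣ a ℚ.- b ∣ ℚ.+ ℚ.∣ b ∣     ≤⟨ ℚ.+-monoˡ-≤ ℚ.∣ b ∣ h ⟩
    δ ℚ.+ ℚ.∣ b ∣                 ∎

  eventually-bounded : ∀ {x} → Cauchy x →
    ∃[ B ] 0ℚ ℚ.< B × (∃[ N ] ∀ n → N ℕ.≤ n → ℚ.∣ x n ∣ ℚ.≤ B)
  eventually-bounded {x} cx with cx 1ℚ (ℚ.positive⁻¹ 1ℚ)
  ... | N , h = 1ℚ ℚ.+ ℚ.∣ x N ∣
    , ℚ.+-mono-<-≤ (ℚ.positive⁻¹ 1ℚ) (ℚ.0≤∣p∣ (x N))
    , N , λ n n≥N → ∣-∣-half (x n) (x N) (h n N n≥N ℕ.≤-refl)

  1/-antimono : ∀ {p q} (p>0 : 0ℚ ℚ.< p) (q>0 : 0ℚ ℚ.< q) → p ℚ.≤ q →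
    (ℚ.1/ q) {{ℚ.>-nonZero q>0}} ℚ.≤ (ℚ.1/ p) {{ℚ.>-nonZero p>0}}
  1/-antimono {p} {q} p>0 q>0 p≤q =
    ℚ.*-cancelˡ-≤-pos p {{p⁺}} (begin
      p ℚ.* q⁻¹    ≤⟨ ℚ.*-monoʳ-≤-nonNeg q⁻¹ {{ℚ.pos⇒nonNeg q⁻¹ {{q⁻¹⁺}}}} p≤q ⟩
      q ℚ.* q⁻¹    ≡⟨ ℚ.*-inverseʳ q {{ℚ.>-nonZero q>0}} ⟩
      1ℚ           ≡⟨ ℚ.*-inverseʳ p {{ℚ.>-nonZero p>0}} ⟨
      p ℚ.* p⁻¹    ∎)
    where
    p⁻¹ q⁻¹ : ℚ
    p⁻¹ = (ℚ.1/ p) {{ℚ.>-nonZero p>0}}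
    q⁻¹ = (ℚ.1/ q) {{ℚ.>-nonZero q>0}}
    p⁺ : ℚ.Positive p
    p⁺ = ℚ.positive p>0
    q⁻¹⁺ : ℚ.Positive q⁻¹
    q⁻¹⁺ = ℚ.1/pos⇒pos q {{ℚ.positive q>0}}

  1/-pos : ∀ {p} (p>0 : 0ℚ ℚ.< p) → 0ℚ ℚ.< (ℚ.1/ p) {{ℚ.>-nonZero p>0}}
  1/-pos {p} p>0 =
    ℚ.positive⁻¹ ((ℚ.1/ p) {{ℚ.>-nonZero p>0}}) {{ℚ.1/pos⇒pos p {{ℚ.positive p>0}}}}

fromℚ : ℚ → ℝ
fromℚ q = mkℝ (λ _ → q) λ δ δ>0 → 0 , λ _ _ _ _ →
  ℚ.≤-trans (ℚ.≤-reflexive (cong ℚ.∣_∣ (ℚ.+-inverseʳ q))) (ℚ.<⇒≤ δ>0)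

fromℕ : ℕ → ℝ
fromℕ n = fromℚ (+ n ℚ./ 1)

0ℝ 1ℝ : ℝ
0ℝ = fromℚ 0ℚ
1ℝ = fromℚ 1ℚ

infixl 6 _+_ _-_
infixl 7 _*_ _⊓_
infix  8 -_

_+_ : ℝ → ℝ → ℝ
x + y = mkℝ (λ n → seq x n ℚ.+ seq y n)
            (lift₂-cauchy ℚ._+_ +-nonexp {seq x} {seq y} (cauchy x) (cauchy y))

-_ : ℝ → ℝ
- x = mkℝ (λ n → ℚ.- seq x n) λ δ δ>0 →
  let N , h = cauchy x δ δ>0 in
  N , λ m n m≥N n≥N → ℚ.≤-trans
    (ℚ.≤-reflexive (trans
      (cong ℚ.∣_∣ (solve 2 (λ a b → (:- a) :- (:- b) := b :- a) refl (seq x m) (seq x n)))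
      (∣a-b∣-sym (seq x n) (seq x m))))
    (h m n m≥N n≥N)

_-_ : ℝ → ℝ → ℝ
x - y = x + (- y)

_⊓_ : ℝ → ℝ → ℝ
x ⊓ y = mkℝ (λ n → seq x n ℚ.⊓ seq y n)
            (lift₂-cauchy ℚ._⊓_ ⊓-nonexp {seq x} {seq y} (cauchy x) (cauchy y))

∣_∣ : ℝ → ℝ
∣ x ∣ = mkℝ (λ n → ℚ.∣ seq x n ∣) λ δ δ>0 →
  let N , h = cauchy x δ δ>0 in
  N , λ m n m≥N n≥N → close
    (∣-∣-half (seq x m) (seq x n) (h m n m≥N n≥N))
    (∣-∣-half (seq x n) (seq x m) (h n m n≥N m≥N))

private abstract
  *-bound : ∀ a b c d {A B e} → 0ℚ ℚ.≤ A → 0ℚ ℚ.≤ e →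
    ℚ.∣ a ∣ ℚ.≤ A → ℚ.∣ d ∣ ℚ.≤ B → ℚ.∣ a ℚ.- c ∣ ℚ.≤ e → ℚ.∣ b ℚ.- d ∣ ℚ.≤ e →
    ℚ.∣ a ℚ.* b ℚ.- c ℚ.* d ∣ ℚ.≤ A ℚ.* e ℚ.+ e ℚ.* B
  *-bound a b c d {A} {B} {e} A≥0 e≥0 ∣a∣≤A ∣d∣≤B ∣a-c∣≤e ∣b-d∣≤e = begin
    ℚ.∣ a ℚ.* b ℚ.- c ℚ.* d ∣
      ≡⟨ cong ℚ.∣_∣ (solve 4 (λ a b c d →
           a :* b :- c :* d := a :* (b :- d) :+ (a :- c) :* d) refl a b c d) ⟩
    ℚ.∣ a ℚ.* (b ℚ.- d) ℚ.+ (a ℚ.- c) ℚ.* d ∣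
      ≤⟨ ℚ.∣p+q∣≤∣p∣+∣q∣ (a ℚ.* (b ℚ.- d)) ((a ℚ.- c) ℚ.* d) ⟩
    ℚ.∣ a ℚ.* (b ℚ.- d) ∣ ℚ.+ ℚ.∣ (a ℚ.- c) ℚ.* d ∣
      ≡⟨ cong₂ ℚ._+_ (ℚ.∣p*q∣≡∣p∣*∣q∣ a (b ℚ.- d)) (ℚ.∣p*q∣≡∣p∣*∣q∣ (a ℚ.- c) d) ⟩
    ℚ.∣ a ∣ ℚ.* ℚ.∣ b ℚ.- d ∣ ℚ.+ ℚ.∣ a ℚ.- c ∣ ℚ.* ℚ.∣ d ∣
      ≤⟨ ℚ.+-mono-≤ (*-mono (ℚ.0≤∣p∣ (b ℚ.- d)) A≥0 ∣a∣≤A ∣b-d∣≤e)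
                    (*-mono (ℚ.0≤∣p∣ d) e≥0 ∣a-c∣≤e ∣d∣≤B) ⟩
    A ℚ.* e ℚ.+ e ℚ.* B ∎

  rescale : ∀ A B δ r → (A ℚ.+ B) ℚ.* r ≡ 1ℚ →
    A ℚ.* (δ ℚ.* r) ℚ.+ (δ ℚ.* r) ℚ.* B ≡ δ
  rescale A B δ r inv = trans
    (solve 4 (λ A B d r → A :* (d :* r) :+ (d :* r) :* B := d :* ((A :+ B) :* r))
      refl A B δ r)
    (trans (cong (δ ℚ.*_) inv) (ℚ.*-identityʳ δ))

  -- A term η with A η + η B = δ, for the product of sequences bounded by A and B.
  margin : ∀ {A B δ} → 0ℚ ℚ.< A → 0ℚ ℚ.< B → 0ℚ ℚ.< δ →
    ∃[ η ] 0ℚ ℚ.< η × A ℚ.* η ℚ.+ η ℚ.* B ≡ δ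
  margin {A} {B} {δ} A>0 B>0 δ>0 =
    δ ℚ.* r , *-pos {δ} {r} δ>0 (1/-pos {A ℚ.+ B} A+B>0) ,
    rescale A B δ r (ℚ.*-inverseʳ (A ℚ.+ B) {{ℚ.>-nonZero A+B>0}})
    where
    A+B>0 : 0ℚ ℚ.< A ℚ.+ B
    A+B>0 = ℚ.+-mono-< {0ℚ} {A} {0ℚ} {B} A>0 B>0
    r : ℚ
    r = (ℚ.1/ (A ℚ.+ B)) {{ℚ.>-nonZero A+B>0}}

  *-cauchy : ∀ {x y} → Cauchy x → Cauchy y → Cauchy (λ n → x n ℚ.* y n)
  *-cauchy {x} {y} cx cy δ δ>0 =
    let A , A>0 , N₁ , bx = eventually-bounded {x} cx
        B , B>0 , N₂ , by = eventually-bounded {y} cy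
        η , η>0 , η-eq = margin {A} {B} {δ} A>0 B>0 δ>0
    in combine A>0 η>0 η-eq (N₁ , bx) (N₂ , by) (cx η η>0) (cy η η>0)
    where
    combine : ∀ {A B η} → 0ℚ ℚ.< A → 0ℚ ℚ.< η → A ℚ.* η ℚ.+ η ℚ.* B ≡ δ →
      (∃[ N ] ∀ n → N ℕ.≤ n → ℚ.∣ x n ∣ ℚ.≤ A) →
      (∃[ N ] ∀ n → N ℕ.≤ n → ℚ.∣ y n ∣ ℚ.≤ B) →
      (∃[ N ] ∀ m n → N ℕ.≤ m → N ℕ.≤ n → ℚ.∣ x m ℚ.- x n ∣ ℚ.≤ η) →
      (∃[ N ] ∀ m n → N ℕ.≤ m → N ℕ.≤ n → ℚ.∣ y m ℚ.- y n ∣ ℚ.≤ η) →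
      ∃[ N ] ∀ m n → N ℕ.≤ m → N ℕ.≤ n → ℚ.∣ x m ℚ.* y m ℚ.- x n ℚ.* y n ∣ ℚ.≤ δ
    combine {A} {B} {η} A>0 η>0 η-eq (N₁ , bx) (N₂ , by) (N₃ , hx) (N₄ , hy) =
      (N₁ ℕ.⊔ N₂) ℕ.⊔ (N₃ ℕ.⊔ N₄) , λ m n m≥ n≥ →
      let m₁ = ℕ.m⊔n≤o⇒m≤o (N₁ ℕ.⊔ N₂) (N₃ ℕ.⊔ N₄) m≥
          n₁ = ℕ.m⊔n≤o⇒m≤o (N₁ ℕ.⊔ N₂) (N₃ ℕ.⊔ N₄) n≥
          m₂ = ℕ.m⊔n≤o⇒n≤o (N₁ ℕ.⊔ N₂) (N₃ ℕ.⊔ N₄) m≥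
          n₂ = ℕ.m⊔n≤o⇒n≤o (N₁ ℕ.⊔ N₂) (N₃ ℕ.⊔ N₄) n≥
      in subst (ℚ.∣ x m ℚ.* y m ℚ.- x n ℚ.* y n ∣ ℚ.≤_) η-eq
        (*-bound (x m) (y m) (x n) (y n) {A} {B} {η} (ℚ.<⇒≤ A>0) (ℚ.<⇒≤ η>0)
          (bx m (ℕ.m⊔n≤o⇒m≤o N₁ N₂ m₁))
          (by n (ℕ.m⊔n≤o⇒n≤o N₁ N₂ n₁))
          (hx m n (ℕ.m⊔n≤o⇒m≤o N₃ N₄ m₂) (ℕ.m⊔n≤o⇒m≤o N₃ N₄ n₂))
          (hy m n (ℕ.m⊔n≤o⇒n≤o N₃ N₄ m₂) (ℕ.m⊔n≤o⇒n≤o N₃ N₄ n₂)))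

_*_ : ℝ → ℝ → ℝ
x * y = mkℝ (λ n → seq x n ℚ.* seq y n) (*-cauchy {seq x} {seq y} (cauchy x) (cauchy y))

private
  abstract
    clamp-pos : ∀ {δ} → 0ℚ ℚ.< δ → ∀ q → 0ℚ ℚ.< q ℚ.⊔ δ
    clamp-pos {δ} δ>0 q = ℚ.<-≤-trans δ>0 (ℚ.p≤q⊔p q δ)

  1/clamp : ∀ {δ} → 0ℚ ℚ.< δ → ℚ → ℚ
  1/clamp {δ} δ>0 q = (ℚ.1/ (q ℚ.⊔ δ)) {{ℚ.>-nonZero (clamp-pos δ>0 q)}}

private abstract
  1/clamp-eq : ∀ {δ} (δ>0 : 0ℚ ℚ.< δ) q → (q ℚ.⊔ δ) ℚ.* 1/clamp δ>0 q ≡ 1ℚ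
  1/clamp-eq {δ} δ>0 q = ℚ.*-inverseʳ (q ℚ.⊔ δ) {{ℚ.>-nonZero (clamp-pos δ>0 q)}}

  1/-difference : ∀ a b s t → a ℚ.* s ≡ 1ℚ → b ℚ.* t ≡ 1ℚ →
    s ℚ.- t ≡ (b ℚ.- a) ℚ.* (s ℚ.* t)
  1/-difference a b s t as≡1 bt≡1 = sym (trans
    (solve 4 (λ a b s t → (b :- a) :* (s :* t) := s :* (b :* t) :- (a :* s) :* t)
      refl a b s t)
    (trans (cong₂ (λ u v → s ℚ.* u ℚ.- v ℚ.* t) bt≡1 as≡1)
      (cong₂ ℚ._-_ (ℚ.*-identityʳ s) (ℚ.*-identityˡ t))))

  1/-bound : ∀ a b s t {r e} → a ℚ.* s ≡ 1ℚ → b ℚ.* t ≡ 1ℚ →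
    0ℚ ℚ.< s → 0ℚ ℚ.< t → s ℚ.≤ r → t ℚ.≤ r → 0ℚ ℚ.≤ e →
    ℚ.∣ b ℚ.- a ∣ ℚ.≤ e → ℚ.∣ s ℚ.- t ∣ ℚ.≤ e ℚ.* (r ℚ.* r)
  1/-bound a b s t {r} {e} as≡1 bt≡1 s>0 t>0 s≤r t≤r e≥0 h = begin
    ℚ.∣ s ℚ.- t ∣                      ≡⟨ cong ℚ.∣_∣ (1/-difference a b s t as≡1 bt≡1) ⟩
    ℚ.∣ (b ℚ.- a) ℚ.* (s ℚ.* t) ∣      ≡⟨ ℚ.∣p*q∣≡∣p∣*∣q∣ (b ℚ.- a) (s ℚ.* t) ⟩
    ℚ.∣ b ℚ.- a ∣ ℚ.* ℚ.∣ s ℚ.* t ∣    ≡⟨ cong (ℚ.∣ b ℚ.- a ∣ ℚ.*_) (ℚ.0≤p⇒∣p∣≡p st≥0) ⟩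
    ℚ.∣ b ℚ.- a ∣ ℚ.* (s ℚ.* t)        ≤⟨ *-mono st≥0 e≥0 h (*-mono (ℚ.<⇒≤ t>0) r≥0 s≤r t≤r) ⟩
    e ℚ.* (r ℚ.* r)                    ∎
    where
    st≥0 : 0ℚ ℚ.≤ s ℚ.* t
    st≥0 = ℚ.<⇒≤ (*-pos s>0 t>0)
    r≥0 : 0ℚ ℚ.≤ r
    r≥0 = ℚ.≤-trans (ℚ.<⇒≤ s>0) s≤r

  rescale² : ∀ ε δ r → δ ℚ.* r ≡ 1ℚ → (ε ℚ.* (δ ℚ.* δ)) ℚ.* (r ℚ.* r) ≡ ε
  rescale² ε δ r inv = trans
    (solve 3 (λ e d r → (e :* (d :* d)) :* (r :* r) := e :* ((d :* r) :* (d :* r)))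
      refl ε δ r)
    (trans (cong (λ c → ε ℚ.* (c ℚ.* c)) inv) (ℚ.*-identityʳ ε))

  1/clamp-inverse : ∀ {δ} (δ>0 : 0ℚ ℚ.< δ) q → δ ℚ.≤ q → q ℚ.* 1/clamp δ>0 q ≡ 1ℚ
  1/clamp-inverse {δ} δ>0 q δ≤q =
    trans (cong (ℚ._* 1/clamp δ>0 q) (sym (ℚ.p≥q⇒p⊔q≡p δ≤q))) (1/clamp-eq δ>0 q)

  1/clamp-cauchy : ∀ {x δ} (δ>0 : 0ℚ ℚ.< δ) →
    (∃[ N ] ∀ n → N ℕ.≤ n → δ ℚ.≤ x n) →
    Cauchy x → Cauchy (λ n → 1/clamp δ>0 (x n))
  1/clamp-cauchy {x} {δ} δ>0 (N , δ≤x) cx ε ε>0 = combine (cx η η>0)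
    where
    r η : ℚ
    r = (ℚ.1/ δ) {{ℚ.>-nonZero δ>0}}
    η = ε ℚ.* (δ ℚ.* δ)
    η>0 : 0ℚ ℚ.< η
    η>0 = *-pos ε>0 (*-pos δ>0 δ>0)
    η-eq : η ℚ.* (r ℚ.* r) ≡ ε
    η-eq = rescale² ε δ r (ℚ.*-inverseʳ δ {{ℚ.>-nonZero δ>0}})
    s>0 : ∀ q → 0ℚ ℚ.< 1/clamp δ>0 q
    s>0 q = 1/-pos (clamp-pos δ>0 q)
    s≤r : ∀ q → 1/clamp δ>0 q ℚ.≤ r
    s≤r q = 1/-antimono δ>0 (clamp-pos δ>0 q) (ℚ.p≤q⊔p q δ)
    combine :
      (∃[ M ] ∀ m n → M ℕ.≤ m → M ℕ.≤ n → ℚ.∣ x m ℚ.- x n ∣ ℚ.≤ η) →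
      ∃[ M ] ∀ m n → M ℕ.≤ m → M ℕ.≤ n →
        ℚ.∣ 1/clamp δ>0 (x m) ℚ.- 1/clamp δ>0 (x n) ∣ ℚ.≤ ε
    combine (M , h) = N ℕ.⊔ M , λ m n m≥ n≥ → ℚ.≤-trans
      (1/-bound (x m) (x n) (1/clamp δ>0 (x m)) (1/clamp δ>0 (x n))
        (1/clamp-inverse δ>0 (x m) (δ≤x m (ℕ.m⊔n≤o⇒m≤o N M m≥)))
        (1/clamp-inverse δ>0 (x n) (δ≤x n (ℕ.m⊔n≤o⇒m≤o N M n≥)))
        (s>0 (x m)) (s>0 (x n)) (s≤r (x m)) (s≤r (x n)) (ℚ.<⇒≤ η>0)
        (h n m (ℕ.m⊔n≤o⇒n≤o N M n≥) (ℕ.m⊔n≤o⇒n≤o N M m≥)))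
      (ℚ.≤-reflexive η-eq)

-- The reciprocal of a positive real.  A proof of 0 < x supplies a rational
-- δ > 0 that is eventually below seq x; replacing seq x n by seq x n ⊔ δ
-- changes only finitely many terms and makes every term invertible.
_⁻¹[_] : (x : ℝ) → 0ℝ < x → ℝ
x ⁻¹[ δ , δ>0 , N , h ] = mkℝ (λ n → 1/clamp δ>0 (seq x n))
  (1/clamp-cauchy {seq x} δ>0
    (N , λ n n≥N → subst (ℚ._≤ seq x n) (ℚ.+-identityˡ δ) (h n n≥N)) (cauchy x))

*-inverseʳ : ∀ x (x>0 : 0ℝ < x) → x * (x ⁻¹[ x>0 ]) ≃ 1ℝ
*-inverseʳ x (δ , δ>0 , N , h) ε ε>0 = N , λ n n≥N → ℚ.≤-trans
  (ℚ.≤-reflexive (cong (λ c → ℚ.∣ c ℚ.- 1ℚ ∣)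
    (1/clamp-inverse δ>0 (seq x n)
      (subst (ℚ._≤ seq x n) (ℚ.+-identityˡ δ) (h n n≥N)))))
  (ℚ.<⇒≤ ε>0)

------------------------------------------------------------------------
-- Finite subsets of ℝ and k-Median

-- An n-element subset of ℝ, listed without repetition.
record FiniteSubset (n : ℕ) : Set where
  field
    point    : Vector ℝ n
    distinct : Injective _≡_ _≃_ point

open FiniteSubset public

_⊆_ : ∀ {m n} → FiniteSubset m → FiniteSubset n → Set
S ⊆ P = ∀ i → ∃[ j ] point S i ≃ point P j

sum : ∀ {n} → Vector ℝ n → ℝ
sum = foldr _+_ 0ℝ

-- The value 0 at the empty vector is a dummy.
minimum : ∀ {n} → Vector ℝ n → ℝ
minimum {zero}  v = 0ℝ
minimum {suc _} v = foldr _⊓_ (head v) (tail v)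

dist : ∀ {k} → ℝ → FiniteSubset k → ℝ
dist p C = minimum (λ j → ∣ p - point C j ∣)

cost : ∀ {n k} → FiniteSubset n → FiniteSubset k → ℝ
cost P C = sum (λ i → dist (point P i) C)

weightedCost : ∀ {s k} (S : FiniteSubset s) → Vector ℝ s → FiniteSubset k → ℝ
weightedCost S w C = sum (λ i → w i * dist (point S i) C)

IsCoreset : ∀ (k : ℕ) (ε : ℝ) {n s} → FiniteSubset n → FiniteSubset s → Set
IsCoreset k ε {n} {s} P S =
  S ⊆ P ×
  (Σ[ w ∈ Vector ℝ s ]
    (∀ i → 0ℝ ≤ w i) ×
    (∀ (C : FiniteSubset k) →
       (1ℝ - ε) * cost P C ≤ weightedCost S w C ×
       weightedCost S w C ≤ (1ℝ + ε) * cost P C))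

{-# OPTIONS --safe #-}
module Submission where

-- Write f for the cost of P and f_S for that of a weighted S ⊆ P.  Let c⁻, c, c⁺ be center
-- sets with d(x,c⁻) + d(x,c⁺) = 2 d(x,c) for every x ∈ S.  Then f_S(c⁻) + f_S(c⁺) = 2 f_S(c)
-- whatever the weights, so a coreset satisfies (1-ε)(f(c⁻) + f(c⁺)) ≤ 2(1+ε) f(c).  A point set
-- for which every small S leaves room for centers violating this forces large coresets.
--
-- For ε ≤ 1/2 let K = k-1, U ≈ K/(32ε), and put 4^(K+U-b) points next to a height y_b ~ 4^b
-- for each b < K+U, so that all classes b have the same mass (number of points times height).
-- If |S| ≤ U, then S misses K classes.  Take c = {0} together with the heights of these, and
-- c∓ = (1∓1/4)c.  On the remaining U classes the distances are linear in the scale, since the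
-- nearest center is always the largest one below the point, and each class costs at most about
-- one mass; each of the K missed classes contributes to f(c⁻) + f(c⁺) about half a mass.
--
-- For ε ≥ 1/2 let P = c = {0,…,k-1}.  If S misses a point, moving only that center by ∓1/4
-- gives f(c) = 0 < f(c⁻) + f(c⁺), so |S| ≥ k.
--
-- Points and centers are rational, and the coreset inequalities are evaluated at one late index
-- of the Cauchy sequences of ε, of the weights and of the points of S.  Since linearity holds
-- exactly in a neighbourhood of each hit point, no estimate of the weights is needed.

open import Algebra.Bundles using (module Ring)
import Algebra.Properties.Semiring.Sum as Sum
open import Data.Fin.Base using (Fin; zero; suc; toℕ; splitAt; inject≤; punchIn; punchOut)
import Data.Fin.Properties as Fin
open import Data.Integer.Base as ℤ using (+_)
import Data.Integer.Properties as ℤ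
open import Data.Nat.Base as ℕ using (ℕ; zero; suc)
open import Data.Nat.Coprimality as Coprime using (Coprime; 1-coprimeTo)
open import Data.Nat.DivMod using (_%_; [m+kn]%n≡m%n; m<n⇒m%n≡m)
import Data.Nat.Properties as ℕ
open import Data.Product.Base using (∃-syntax; Σ-syntax; _×_; _,_; proj₁; proj₂)
open import Data.Rational.Base as ℚ using (ℚ; 0ℚ; 1ℚ; ½)
import Data.Rational.Properties as ℚ
open import Data.Rational.Solver using (module +-*-Solver)
open import Data.Sum.Base using (_⊎_; inj₁; inj₂; [_,_]′; map)
open import Data.Vec.Functional using (Vector; head; tail; foldr)
open import Function.Base using (_∘_; id)
open import Function.Definitions using (Injective)
open import Relation.Binary.Definitions using (tri<; tri≈; tri>)
open import Relation.Binary.PropositionalEquality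
  using (_≡_; _≢_; refl; sym; trans; cong; cong₂; subst; subst₂; module ≡-Reasoning)
open import Relation.Nullary using (¬_; Dec; yes; no; contradiction)

-- Rational arithmetic and distances to finite center sets.

module Rational where
  open import Data.Rational.Base
  open +-*-Solver using (solve; _:=_; _:+_; _:*_; _:-_; :-_; con) public

  ¼ ¾ 1¼ 1½ 4ℚ : ℚ
  ¼ = + 1 / 4
  ¾ = + 3 / 4
  1¼ = + 5 / 4
  1½ = + 3 / 2
  4ℚ = + 4 / 1

  infixr 2 _⊕_
  infixr 3 _⊙_

  -- Linear arithmetic: a ≤ b is certified by writing b as a plus a nonnegative
  -- combination of slacks r - l of inequalities l ≤ r.
  abstract
    ⟦_⟧ : ∀ {l r} → l ≤ r → 0ℚ ≤ r - l
    ⟦_⟧ {l} {r} l≤r = subst (_≤ r - l) (ℚ.+-inverseʳ l) (ℚ.+-monoˡ-≤ (- l) l≤r)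

    _⊕_ : ∀ {a b} → 0ℚ ≤ a → 0ℚ ≤ b → 0ℚ ≤ a + b
    _⊕_ = ℚ.+-mono-≤

    *-nonNeg : ∀ {a b} → 0ℚ ≤ a → 0ℚ ≤ b → 0ℚ ≤ a * b
    *-nonNeg {a} {b} a≥0 b≥0 =
      subst (_≤ a * b) (ℚ.*-zeroʳ a) (ℚ.*-monoˡ-≤-nonNeg a {{nonNegative a≥0}} b≥0)

    _⊙_ : ∀ c {{_ : NonNegative c}} {a} → 0ℚ ≤ a → 0ℚ ≤ c * a
    _⊙_ c = *-nonNeg (ℚ.nonNegative⁻¹ c)

    ≤-by : ∀ {a b e} → 0ℚ ≤ e → b ≡ a + e → a ≤ b
    ≤-by {a} {b} {e} e≥0 eq = begin
      a       ≡⟨ ℚ.+-identityʳ a ⟨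
      a + 0ℚ  ≤⟨ ℚ.+-monoʳ-≤ a e≥0 ⟩
      a + e   ≡⟨ eq ⟨
      b       ∎
      where open ℚ.≤-Reasoning

    <-by : ∀ {a b e} → 0ℚ < e → b ≡ a + e → a < b
    <-by {a} {b} {e} e>0 eq = begin-strict
      a       ≡⟨ ℚ.+-identityʳ a ⟨
      a + 0ℚ  <⟨ ℚ.+-monoʳ-< a e>0 ⟩
      a + e   ≡⟨ eq ⟨
      b       ∎
      where open ℚ.≤-Reasoning

    *-pos : ∀ {a b} → 0ℚ < a → 0ℚ < b → 0ℚ < a * b
    *-pos {a} {b} a>0 b>0 =
      subst (_< a * b) (ℚ.*-zeroʳ a) (ℚ.*-monoʳ-<-pos a {{positive a>0}} b>0)

    ∣∣-lub : ∀ {p q} → p ≤ q → - p ≤ q → ∣ p ∣ ≤ q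
    ∣∣-lub {p} p≤q -p≤q =
      [ (λ eq → subst (_≤ _) (sym eq) p≤q) , (λ eq → subst (_≤ _) (sym eq) -p≤q) ]′
        (ℚ.∣p∣≡p∨∣p∣≡-p p)

    p≤∣p∣ : ∀ p → p ≤ ∣ p ∣
    p≤∣p∣ p = [ (λ h → ℚ.≤-reflexive (sym (ℚ.0≤p⇒∣p∣≡p h)))
              , (λ h → ℚ.≤-trans h (ℚ.0≤∣p∣ p)) ]′ (ℚ.≤-total 0ℚ p)

    -p≤∣p∣ : ∀ p → - p ≤ ∣ p ∣
    -p≤∣p∣ p = subst (- p ≤_) (ℚ.∣-p∣≡∣p∣ p) (p≤∣p∣ (- p))

    x-c≤∣x-c∣ : ∀ x c → x - c ≤ ∣ x - c ∣
    x-c≤∣x-c∣ x c = p≤∣p∣ (x - c)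

    c-x≤∣x-c∣ : ∀ x c → c - x ≤ ∣ x - c ∣
    c-x≤∣x-c∣ x c = subst (_≤ ∣ x - c ∣)
      (solve 2 (λ x c → :- (x :- c) := c :- x) refl x c) (-p≤∣p∣ (x - c))

    ∣x-c∣≡x-c : ∀ {x c} → c ≤ x → ∣ x - c ∣ ≡ x - c
    ∣x-c∣≡x-c c≤x = ℚ.0≤p⇒∣p∣≡p ⟦ c≤x ⟧

    ≤-limit : ∀ {a b} → (∀ δ → 0ℚ < δ → a ≤ b + δ) → a ≤ b
    ≤-limit {a} {b} h = ℚ.≮⇒≥ λ b<a →
      let m , b<m , m<a = ℚ.<-dense b<a
          b+[m-b]≡m = solve 2 (λ b m → b :+ (m :- b) := m) refl b m
      in ℚ.<-irrefl refl (ℚ.≤-<-trans (subst (a ≤_) b+[m-b]≡m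
           (h (m - b) (subst (_< m - b) (ℚ.+-inverseʳ b) (ℚ.+-monoˡ-< (- b) b<m)))) m<a)

  minimumℚ : ∀ {n} → Vector ℚ (suc n) → ℚ
  minimumℚ v = foldr _⊓_ (head v) (tail v)

  distℚ : ∀ {n} → ℚ → Vector ℚ (suc n) → ℚ
  distℚ x c = minimumℚ (λ j → ∣ x - c j ∣)

  abstract
    foldr-⊓-≤ : ∀ {n} z (v : Vector ℚ n) → foldr _⊓_ z v ≤ z × (∀ j → foldr _⊓_ z v ≤ v j)
    foldr-⊓-≤ {zero}  z v = ℚ.≤-refl , λ ()
    foldr-⊓-≤ {suc n} z v =
      let tail≤z , tail≤ = foldr-⊓-≤ z (tail v)
          ≤tail = ℚ.p⊓q≤q (head v) (foldr _⊓_ z (tail v))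
      in ℚ.≤-trans ≤tail tail≤z , λ where
        zero    → ℚ.p⊓q≤p (head v) _
        (suc j) → ℚ.≤-trans ≤tail (tail≤ j)

    foldr-⊓-sel : ∀ {n} z (v : Vector ℚ n) →
      foldr _⊓_ z v ≡ z ⊎ (∃[ j ] foldr _⊓_ z v ≡ v j)
    foldr-⊓-sel {zero}  z v = inj₁ refl
    foldr-⊓-sel {suc n} z v with ℚ.⊓-sel (head v) (foldr _⊓_ z (tail v))
    ... | inj₁ eq = inj₂ (zero , eq)
    ... | inj₂ eq with foldr-⊓-sel z (tail v)
    ...   | inj₁ eq′       = inj₁ (trans eq eq′)
    ...   | inj₂ (j , eq′) = inj₂ (suc j , trans eq eq′)

    minimumℚ-≤ : ∀ {n} (v : Vector ℚ (suc n)) j → minimumℚ v ≤ v j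
    minimumℚ-≤ v zero    = proj₁ (foldr-⊓-≤ (head v) (tail v))
    minimumℚ-≤ v (suc j) = proj₂ (foldr-⊓-≤ (head v) (tail v)) j

    minimumℚ-sel : ∀ {n} (v : Vector ℚ (suc n)) → ∃[ j ] minimumℚ v ≡ v j
    minimumℚ-sel v = [ zero ,_ , (λ (j , eq) → suc j , eq) ]′ (foldr-⊓-sel (head v) (tail v))

    minimumℚ-glb : ∀ {n} (v : Vector ℚ (suc n)) {b} → (∀ j → b ≤ v j) → b ≤ minimumℚ v
    minimumℚ-glb v {b} b≤ = let j , eq = minimumℚ-sel v in subst (b ≤_) (sym eq) (b≤ j)

    minimumℚ-≡ : ∀ {n} (v : Vector ℚ (suc n)) j → (∀ i → v j ≤ v i) → minimumℚ v ≡ v j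
    minimumℚ-≡ v j least = ℚ.≤-antisym (minimumℚ-≤ v j) (minimumℚ-glb v least)

    distℚ-nonNeg : ∀ {n} x (c : Vector ℚ (suc n)) → 0ℚ ≤ distℚ x c
    distℚ-nonNeg x c = minimumℚ-glb _ λ j → ℚ.0≤∣p∣ (x - c j)

  scale : ∀ {n} → ℚ → Vector ℚ n → Vector ℚ n
  scale μ v j = μ * v j

  -- The factor 4 leaves room for two perturbations at once: points anywhere between y/2 and 3y/2,
  -- and centers rescaled by anything between 3/4 and 5/4.
  Separated : ℚ → ℚ → Set
  Separated y v = 4ℚ * v ≤ y ⊎ 4ℚ * y ≤ v

  -- Centers above x are farther away than the center 0, so the nearest center is
  -- the largest one below x, and it stays so under rescaling of all centers.
  module _ {n} (v : Vector ℚ (suc n)) (v≥0 : ∀ j → 0ℚ ≤ v j) (v₀≡0 : v zero ≡ 0ℚ)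
           {x y : ℚ} (½y≤x : ½ * y ≤ x) (x≤1½y : x ≤ 1½ * y) (y≥0 : 0ℚ ≤ y)
           (sep : ∀ j → Separated y (v j)) where abstract

    private
      x≥0 : 0ℚ ≤ x
      x≥0 = ℚ.≤-trans (½ ⊙ y≥0) ½y≤x

      dist₀ : ∣ x - v zero ∣ ≡ x
      dist₀ = trans (cong (λ c → ∣ x - c ∣) v₀≡0)
        (trans (∣x-c∣≡x-c x≥0) (solve 1 (λ x → x :- con 0ℚ := x) refl x))

      nearest : Fin (suc n)
      nearest = proj₁ (minimumℚ-sel (λ j → ∣ x - v j ∣))

      nearest-≤ : ∀ j → ∣ x - v nearest ∣ ≤ ∣ x - v j ∣
      nearest-≤ j = subst (_≤ ∣ x - v j ∣) (proj₂ (minimumℚ-sel (λ j → ∣ x - v j ∣)))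
        (minimumℚ-≤ (λ j → ∣ x - v j ∣) j)

      -- The rescaled center is at least 3y ≥ 2x, so it is no closer to x than 0 is.
      far : ∀ {μ} j → ¾ ≤ μ → 4ℚ * y ≤ v j → x ≤ ∣ x - μ * v j ∣
      far {μ} j ¾≤μ 4y≤v = ℚ.≤-trans
        (≤-by (*-nonNeg ⟦ ¾≤μ ⟧ (v≥0 j) ⊕ ¾ ⊙ ⟦ 4y≤v ⟧ ⊕ + 2 / 1 ⊙ ⟦ x≤1½y ⟧)
          (solve 4 (λ x y v μ → μ :* v :- x := x :+
              ((μ :- con ¾) :* v :+ (con ¾ :* (v :- con 4ℚ :* y)
                :+ con (+ 2 / 1) :* (con 1½ :* y :- x)))) refl x y (v j) μ))
        (c-x≤∣x-c∣ x (μ * v j))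

      below : ∀ {μ} j → 0ℚ ≤ μ → μ ≤ 1¼ → 4ℚ * v j ≤ y → μ * v j ≤ x
      below {μ} j μ≥0 μ≤1¼ 4v≤y = ≤-by
        (⟦ ½y≤x ⟧ ⊕ *-nonNeg ⟦ μ≤1¼ ⟧ (v≥0 j) ⊕ + 5 / 16 ⊙ ⟦ 4v≤y ⟧ ⊕ + 3 / 16 ⊙ y≥0)
        (solve 4 (λ x y v μ → x := μ :* v :+ ((x :- con ½ :* y) :+
            ((con 1¼ :- μ) :* v :+ (con (+ 5 / 16) :* (y :- con 4ℚ :* v)
              :+ con (+ 3 / 16) :* y)))) refl x y (v j) μ)

      1* : ∀ j → 1ℚ * v j ≡ v j
      1* j = ℚ.*-identityˡ (v j)

      small⇒≤x : ∀ j → 4ℚ * v j ≤ y → v j ≤ x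
      small⇒≤x j 4v≤y = subst (_≤ x) (1* j)
        (below j (ℚ.nonNegative⁻¹ 1ℚ) (≤-by (ℚ.nonNegative⁻¹ ¼) refl) 4v≤y)

      -- Being no farther from x than 0, the nearest center is at most 2x ≤ 3y. In the second case
      -- this leaves only y = 0 with the center at 0, where the claim still holds; the certificate
      -- derives it without isolating that case.
      nearest-small : 4ℚ * v nearest ≤ y
      nearest-small with sep nearest
      ... | inj₁ 4v≤y = 4v≤y
      ... | inj₂ 4y≤v = ≤-by
        (+ 15 / 1 ⊙ ⟦ v-x≤x ⟧ ⊕ + 11 / 1 ⊙ ⟦ 4y≤v ⟧ ⊕ + 30 / 1 ⊙ ⟦ x≤1½y ⟧)
        (solve 3 (λ x y v → y := con 4ℚ :* v :+ (con (+ 15 / 1) :* (x :- (v :- x)) :+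
            (con (+ 11 / 1) :* (v :- con 4ℚ :* y) :+ con (+ 30 / 1) :* (con 1½ :* y :- x))))
          refl x y (v nearest))
        where
        v-x≤x : v nearest - x ≤ x
        v-x≤x = ℚ.≤-trans (c-x≤∣x-c∣ x (v nearest))
          (subst (∣ x - v nearest ∣ ≤_) dist₀ (nearest-≤ zero))

      -- Both centers lie below x, so the smaller distance belongs to the larger center.
      nearest-largest : ∀ j → 4ℚ * v j ≤ y → v j ≤ v nearest
      nearest-largest j 4v≤y = ≤-by
        ⟦ subst₂ _≤_ (∣x-c∣≡x-c (small⇒≤x nearest nearest-small)) (∣x-c∣≡x-c (small⇒≤x j 4v≤y))
            (nearest-≤ j) ⟧
        (solve 3 (λ x a b → a := b :+ ((x :- b) :- (x :- a))) refl x (v nearest) (v j))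

    -- One `c` serves every scale, which makes the distance affine in μ on [3/4, 5/4]: small centers
    -- keep their order, and large ones remain at distance at least x.
    distℚ-scale : ∃[ c ] 0ℚ ≤ c ×
      (∀ {μ} → ¾ ≤ μ → μ ≤ 1¼ → distℚ x (scale μ v) ≡ x - μ * c)
    distℚ-scale = v nearest , v≥0 nearest , λ {μ} ¾≤μ μ≤1¼ →
      let μ≥0 = ℚ.≤-trans (ℚ.nonNegative⁻¹ ¾) ¾≤μ
          near≡ = ∣x-c∣≡x-c (below nearest μ≥0 μ≤1¼ nearest-small)
          near≤x = ≤-by {x - μ * v nearest} {x} (*-nonNeg μ≥0 (v≥0 nearest))
            (solve 3 (λ x v μ → x := (x :- μ :* v) :+ μ :* v) refl x (v nearest) μ)
          near≤ : ∀ j → Separated y (v j) → x - μ * v nearest ≤ ∣ x - μ * v j ∣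
          near≤ = λ where
            j (inj₁ 4v≤y) → ℚ.≤-trans
              (≤-by (*-nonNeg μ≥0 ⟦ nearest-largest j 4v≤y ⟧)
                (solve 4 (λ x a b μ → x :- μ :* b := (x :- μ :* a) :+ μ :* (a :- b))
                  refl x (v nearest) (v j) μ))
              (x-c≤∣x-c∣ x (μ * v j))
            j (inj₂ 4y≤v) → ℚ.≤-trans near≤x (far j ¾≤μ 4y≤v)
      in trans (minimumℚ-≡ _ nearest λ j → subst (_≤ ∣ x - μ * v j ∣) (sym near≡) (near≤ j (sep j)))
               near≡

  -- Naturals inside the rationals, and finite sums.

  open Sum (Ring.semiring ℚ.+-*-ring) using (sum; sum-remove; sum-cong-≗)

  abstract
    ι-coprime : ∀ n → Coprime n 1
    ι-coprime n = Coprime.sym (1-coprimeTo n)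

    ι : ℕ → ℚ
    ι n = + n / 1

    ι≡/1 : ∀ n → ι n ≡ + n / 1
    ι≡/1 n = refl

    ι0≡0 : ι 0 ≡ 0ℚ
    ι0≡0 = refl

    ι1≡1 : ι 1 ≡ 1ℚ
    ι1≡1 = refl

    ι-+ : ∀ m n → ι (m ℕ.+ n) ≡ ι m + ι n
    ι-+ m n
      rewrite ℚ.normalize-coprime (ι-coprime m) | ℚ.normalize-coprime (ι-coprime n)
            | ℤ.*-identityʳ (+ m) | ℤ.*-identityʳ (+ n) = refl

    ι-* : ∀ m n → ι (m ℕ.* n) ≡ ι m * ι n
    ι-* m n
      rewrite ℚ.normalize-coprime (ι-coprime m) | ℚ.normalize-coprime (ι-coprime n)
      = cong (_/ 1) (ℤ.pos-* m n)

    ι-mono : ∀ {m n} → m ℕ.≤ n → ι m ≤ ι n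
    ι-mono {m} {n} m≤n
      rewrite ℚ.normalize-coprime (ι-coprime m) | ℚ.normalize-coprime (ι-coprime n)
      = *≤* (ℤ.*-monoʳ-≤-nonNeg (+ 1) (ℤ.+≤+ m≤n))

    ι-injective : ∀ {m n} → ι m ≡ ι n → m ≡ n
    ι-injective {m} {n} eq
      rewrite ℚ.normalize-coprime (ι-coprime m) | ℚ.normalize-coprime (ι-coprime n)
      = ℤ.+-injective (cong ↥_ eq)

  abstract
    ι-nonNeg : ∀ n → 0ℚ ≤ ι n
    ι-nonNeg n = subst (_≤ ι n) ι0≡0 (ι-mono {0} {n} ℕ.z≤n)

    ι-suc : ∀ n → ι (suc n) ≡ 1ℚ + ι n
    ι-suc n = trans (ι-+ 1 n) (cong (_+ ι n) ι1≡1)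

    ι-suc-pos : ∀ n → 0ℚ < ι (suc n)
    ι-suc-pos n = ℚ.<-≤-trans (ℚ.positive⁻¹ 1ℚ) (subst (_≤ ι (suc n)) ι1≡1 (ι-mono {1} {suc n} (ℕ.s≤s ℕ.z≤n)))

    1+ι≤ : ∀ {m n} → m ℕ.< n → 1ℚ + ι m ≤ ι n
    1+ι≤ {m} {n} m<n = subst (_≤ ι n) (ι-suc m) (ι-mono {suc m} {n} m<n)

    sum-mono : ∀ {n} {f g : Vector ℚ n} → (∀ i → f i ≤ g i) → sum f ≤ sum g
    sum-mono {zero}  f≤g = ℚ.≤-refl
    sum-mono {suc n} f≤g = ℚ.+-mono-≤ (f≤g zero) (sum-mono (f≤g ∘ suc))

    sum-nonNeg : ∀ {n} {f : Vector ℚ n} → (∀ i → 0ℚ ≤ f i) → 0ℚ ≤ sum f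
    sum-nonNeg {zero}  f≥0 = ℚ.≤-refl
    sum-nonNeg {suc n} f≥0 = f≥0 zero ⊕ sum-nonNeg (f≥0 ∘ suc)

    sum-const : ∀ n a → sum {n} (λ _ → a) ≡ ι n * a
    sum-const zero    a = sym (trans (cong (_* a) ι0≡0) (ℚ.*-zeroˡ a))
    sum-const (suc n) a = trans (cong (λ b → a + b) (sum-const n a))
      (trans (solve 2 (λ a n → a :+ n :* a := (con 1ℚ :+ n) :* a) refl a (ι n))
        (cong (_* a) (sym (ι-suc n))))

    -- Induction on m: the term at `g zero` is split off on both sides, and `punchOut` keeps the
    -- rest of `g` injective into the remaining indices. Nonnegativity accounts for the entries
    -- outside the range of `g`.
    sum-injective-≤ : ∀ {m n} {e : Vector ℚ n} (g : Fin m → Fin n) → (∀ b → 0ℚ ≤ e b) →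
      Injective _≡_ _≡_ g → sum (e ∘ g) ≤ sum e
    sum-injective-≤ {zero}          g e≥0 inj = sum-nonNeg e≥0
    sum-injective-≤ {suc m} {zero}  g e≥0 inj = contradiction (g zero) Fin.¬Fin0
    sum-injective-≤ {suc m} {suc n} {e} g e≥0 inj = begin
      e (g zero) + sum (e ∘ g ∘ suc)
        ≡⟨ cong (λ b → e (g zero) + b)
             (sum-cong-≗ λ j → cong e (sym (Fin.punchIn-punchOut (g₀≢ j)))) ⟩
      e (g zero) + sum (e ∘ punchIn (g zero) ∘ g′)
        ≤⟨ ℚ.+-monoʳ-≤ (e (g zero)) (sum-injective-≤ g′ (e≥0 ∘ punchIn (g zero)) inj′) ⟩
      e (g zero) + sum (e ∘ punchIn (g zero))
        ≡⟨ sum-remove {i = g zero} e ⟨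
      sum e ∎
      where
      open ℚ.≤-Reasoning
      g₀≢ : ∀ j → g zero ≢ g (suc j)
      g₀≢ j eq with () ← inj eq
      g′ : Fin m → Fin n
      g′ j = punchOut (g₀≢ j)
      inj′ : Injective _≡_ _≡_ g′
      inj′ {i} {j} eq = Fin.suc-injective (inj (Fin.punchOut-injective (g₀≢ i) (g₀≢ j) eq))

  -- Classes with multiplicities.

  size : ∀ {t} → Vector ℕ t → ℕ
  size = foldr ℕ._+_ 0

  -- Class b occupies a block of `m b` consecutive indices, so that a sum over points turns into a
  -- sum over classes weighted by `m`.
  level : ∀ {t} (m : Vector ℕ t) → Fin (size m) → Fin t
  level {suc t} m i = [ (λ _ → zero) , suc ∘ level (tail m) ]′ (splitAt (m zero) i)

  abstract
    sum-split : ∀ m {n} (h₁ : Fin m → ℚ) (h₂ : Fin n → ℚ) →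
      sum ([ h₁ , h₂ ]′ ∘ splitAt m) ≡ sum h₁ + sum h₂
    sum-split zero    h₁ h₂ = sym (ℚ.+-identityˡ (sum h₂))
    sum-split (suc m) h₁ h₂ = trans
      (cong (λ b → h₁ zero + b)
        (trans (sum-cong-≗ λ i → case-map (splitAt m i)) (sum-split m (h₁ ∘ suc) h₂)))
      (sym (ℚ.+-assoc (h₁ zero) (sum (h₁ ∘ suc)) (sum h₂)))
      where
      case-map : ∀ (s : Fin m ⊎ Fin _) → [ h₁ , h₂ ]′ (map suc id s) ≡ [ h₁ ∘ suc , h₂ ]′ s
      case-map (inj₁ _) = refl
      case-map (inj₂ _) = refl

    sum-level : ∀ {t} (m : Vector ℕ t) (h : Fin t → ℚ) →
      sum (h ∘ level m) ≡ sum (λ b → ι (m b) * h b)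
    sum-level {zero}  m h = refl
    sum-level {suc t} m h = trans (sum-cong-≗ λ i → case-out (splitAt (m zero) i))
      (trans (sum-split (m zero) (λ _ → h zero) (h ∘ suc ∘ level (tail m)))
        (cong₂ _+_ (sum-const (m zero) (h zero)) (sum-level (tail m) (h ∘ suc))))
      where
      case-out : ∀ (s : Fin (m zero) ⊎ Fin (size (tail m))) → h ([ (λ _ → zero) , suc ∘ level (tail m) ]′ s)
                     ≡ [ (λ _ → h zero) , h ∘ suc ∘ level (tail m) ]′ s
      case-out (inj₁ _) = refl
      case-out (inj₂ _) = refl

    -- Induction on s: ask for one index more than required that avoids the tail of `f`, then drop
    -- the one equal to `f zero`, or an arbitrary one if there is none.
    avoid : ∀ {s t} k (f : Fin s → Fin t) → s ℕ.+ k ℕ.≤ t →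
      Σ[ g ∈ (Fin k → Fin t) ] Injective _≡_ _≡_ g × (∀ i j → f i ≢ g j)
    avoid {zero}  k f k≤t = (λ j → inject≤ j k≤t) , Fin.inject≤-injective k≤t k≤t _ _ , λ ()
    avoid {suc s} {t} k f s+k≤t
      with avoid (suc k) (f ∘ suc) (subst (ℕ._≤ t) (sym (ℕ.+-suc s k)) s+k≤t)
    ... | g , inj , f≢g with Fin.any? (λ j → f zero Fin.≟ g j)
    ...   | yes (j₀ , eq) = g ∘ punchIn j₀ , Fin.punchIn-injective j₀ _ _ ∘ inj , λ where
      zero    j f₀≡ → Fin.punchInᵢ≢i j₀ j (inj (trans (sym f₀≡) eq))
      (suc i) j     → f≢g i (punchIn j₀ j)
    ...   | no f₀≢ = g ∘ suc , Fin.suc-injective ∘ inj , λ where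
      zero    j f₀≡ → f₀≢ (suc j , f₀≡)
      (suc i) j     → f≢g i (suc j)

-- Distances and gaps for perturbed centers.

module Gaps where
  open Rational
  open import Data.Rational.Base
  open Sum (Ring.semiring ℚ.+-*-ring) using (sum)

  module _ {n} (v : Vector ℚ (suc n)) (v≥0 : ∀ j → 0ℚ ≤ v j)
           {x y : ℚ} (y≤x : y ≤ x) (x≤y+ : x ≤ + 49 / 48 * y) (y≥0 : 0ℚ ≤ y)
           (j₀ : Fin (suc n)) (v≡y : v j₀ ≡ y)
           (sep : ∀ j → j ≢ j₀ → Separated y (v j)) where abstract

    distℚ-selected : distℚ x (scale 1ℚ v) ≤ + 1 / 48 * y
    distℚ-selected = ℚ.≤-trans (minimumℚ-≤ (λ j → ∣ x - scale 1ℚ v j ∣) j₀)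
      (subst (λ c → ∣ x - c ∣ ≤ + 1 / 48 * y) (sym (trans (ℚ.*-identityˡ (v j₀)) v≡y))
        (subst (_≤ + 1 / 48 * y) (sym (∣x-c∣≡x-c y≤x))
          (≤-by ⟦ x≤y+ ⟧ (solve 2 (λ x y →
            con (+ 1 / 48) :* y := (x :- y) :+ (con (+ 49 / 48) :* y :- x)) refl x y))))

    -- The shrunk own center leaves y/4, more than the 11/48 shared with `distℚ-selected-1¼`. Other
    -- centers are farther: smaller ones end up at most 3y/16, larger ones at least 3y.
    distℚ-selected-¾ : + 11 / 48 * y ≤ distℚ x (scale ¾ v)
    distℚ-selected-¾ = minimumℚ-glb _ λ j → bound j
      where
      bound : ∀ j → + 11 / 48 * y ≤ ∣ x - ¾ * v j ∣
      bound j with j Fin.≟ j₀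
      ... | yes refl rewrite v≡y = ℚ.≤-trans
        (≤-by (⟦ y≤x ⟧ ⊕ + 1 / 48 ⊙ y≥0) (solve 2 (λ x y →
          x :- con ¾ :* y := con (+ 11 / 48) :* y :+ ((x :- y) :+ con (+ 1 / 48) :* y)) refl x y))
        (x-c≤∣x-c∣ x (¾ * y))
      ... | no j≢j₀ with sep j j≢j₀
      ...   | inj₁ 4v≤y = ℚ.≤-trans
        (≤-by (⟦ y≤x ⟧ ⊕ + 3 / 16 ⊙ ⟦ 4v≤y ⟧ ⊕ + 28 / 48 ⊙ y≥0) (solve 3 (λ x y v →
          x :- con ¾ :* v := con (+ 11 / 48) :* y :+ ((x :- y) :+
            (con (+ 3 / 16) :* (y :- con 4ℚ :* v) :+ con (+ 28 / 48) :* y))) refl x y (v j)))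
        (x-c≤∣x-c∣ x (¾ * v j))
      ...   | inj₂ 4y≤v = ℚ.≤-trans
        (≤-by (⟦ x≤y+ ⟧ ⊕ ¾ ⊙ ⟦ 4y≤v ⟧ ⊕ + 84 / 48 ⊙ y≥0) (solve 3 (λ x y v →
          con ¾ :* v :- x := con (+ 11 / 48) :* y :+ ((con (+ 49 / 48) :* y :- x) :+
            (con ¾ :* (v :- con 4ℚ :* y) :+ con (+ 84 / 48) :* y))) refl x y (v j)))
        (c-x≤∣x-c∣ x (¾ * v j))

    -- The constant is 5/4 - 49/48, attained by the enlarged own center when x is as large as
    -- allowed.
    distℚ-selected-1¼ : + 11 / 48 * y ≤ distℚ x (scale 1¼ v)
    distℚ-selected-1¼ = minimumℚ-glb _ λ j → bound j
      where
      bound : ∀ j → + 11 / 48 * y ≤ ∣ x - 1¼ * v j ∣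
      bound j with j Fin.≟ j₀
      ... | yes refl rewrite v≡y = ℚ.≤-trans
        (≤-by ⟦ x≤y+ ⟧ (solve 2 (λ x y →
          con 1¼ :* y :- x := con (+ 11 / 48) :* y :+ (con (+ 49 / 48) :* y :- x)) refl x y))
        (c-x≤∣x-c∣ x (1¼ * y))
      ... | no j≢j₀ with sep j j≢j₀
      ...   | inj₁ 4v≤y = ℚ.≤-trans
        (≤-by (⟦ y≤x ⟧ ⊕ + 5 / 16 ⊙ ⟦ 4v≤y ⟧ ⊕ + 22 / 48 ⊙ y≥0) (solve 3 (λ x y v →
          x :- con 1¼ :* v := con (+ 11 / 48) :* y :+ ((x :- y) :+
            (con (+ 5 / 16) :* (y :- con 4ℚ :* v) :+ con (+ 22 / 48) :* y))) refl x y (v j)))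
        (x-c≤∣x-c∣ x (1¼ * v j))
      ...   | inj₂ 4y≤v = ℚ.≤-trans
        (≤-by (⟦ x≤y+ ⟧ ⊕ 1¼ ⊙ ⟦ 4y≤v ⟧ ⊕ + 180 / 48 ⊙ y≥0) (solve 3 (λ x y v →
          con 1¼ :* v :- x := con (+ 11 / 48) :* y :+ ((con (+ 49 / 48) :* y :- x) :+
            (con 1¼ :* (v :- con 4ℚ :* y) :+ con (+ 180 / 48) :* y))) refl x y (v j)))
        (c-x≤∣x-c∣ x (1¼ * v j))

  Linear : ∀ {n} (c⁻ c c⁺ : Vector ℚ (suc n)) → ℚ → Set
  Linear c⁻ c c⁺ x = distℚ x c⁻ + distℚ x c⁺ ≡ distℚ x c + distℚ x c

  -- Summed over P, this is nonpositive for a coreset of precision q that is Linear on S.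
  gap : ∀ {n} → ℚ → (c⁻ c c⁺ : Vector ℚ (suc n)) → ℚ → ℚ
  gap q c⁻ c c⁺ x =
    (1ℚ - q) * (distℚ x c⁻ + distℚ x c⁺) - (1ℚ + q) * (distℚ x c + distℚ x c)

  -- Linearity is demanded on a ¼-neighbourhood because a point of S equals `p (f i)` only as a real
  -- number: its rational approximations at a late index merely lie near `p (f i)`. Injectivity
  -- makes each center vector a set of exactly k+1 reals.
  record Refutation {n s} (k : ℕ) (q : ℚ) (p : Vector ℚ n) (f : Fin s → Fin n) : Set where
    field
      c⁻ c c⁺      : Vector ℚ (suc k)
      c⁻-injective : Injective _≡_ _≡_ c⁻
      c-injective  : Injective _≡_ _≡_ c
      c⁺-injective : Injective _≡_ _≡_ c⁺
      linear       : ∀ i x → ∣ x - p (f i) ∣ ≤ ¼ → Linear c⁻ c c⁺ x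
      gap-pos      : 0ℚ < sum (gap q c⁻ c c⁺ ∘ p)

  abstract
    -- The scales 3/4 and 5/4 average to 1, and by `distℚ-scale` the distance is x - μc. The bound
    -- by x follows from c ≥ 0.
    linear-scale : ∀ {n} (v : Vector ℚ (suc n)) → (∀ j → 0ℚ ≤ v j) → v zero ≡ 0ℚ →
      ∀ {x y} → ½ * y ≤ x → x ≤ 1½ * y → 0ℚ ≤ y → (∀ j → Separated y (v j)) →
      Linear (scale ¾ v) (scale 1ℚ v) (scale 1¼ v) x × distℚ x (scale 1ℚ v) ≤ x
    linear-scale v v≥0 v₀≡0 {x} ½y≤x x≤1½y y≥0 sep =
      let c , c≥0 , dist≡ = distℚ-scale v v≥0 v₀≡0 ½y≤x x≤1½y y≥0 sep
          dist¾ = dist≡ {¾} ℚ.≤-refl (≤-by (ℚ.nonNegative⁻¹ ½) refl)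
          dist1 = dist≡ {1ℚ} (≤-by (ℚ.nonNegative⁻¹ ¼) refl) (≤-by (ℚ.nonNegative⁻¹ ¼) refl)
          dist1¼ = dist≡ {1¼} (≤-by (ℚ.nonNegative⁻¹ ½) refl) ℚ.≤-refl
      in trans (cong₂ _+_ dist¾ dist1¼)
           (trans (solve 2 (λ x c → (x :- con ¾ :* c) :+ (x :- con 1¼ :* c)
                       := (x :- con 1ℚ :* c) :+ (x :- con 1ℚ :* c)) refl x c)
             (sym (cong₂ _+_ dist1 dist1)))
         , subst (_≤ x) (sym dist1)
             (≤-by c≥0 (solve 2 (λ x c → x := (x :- con 1ℚ :* c) :+ c) refl x c))

    -- Both pairs of distances sum to 2d, and the factors 1 - q and 1 + q differ by 2q.
    gap-linear : ∀ {n} q x (c⁻ c c⁺ : Vector ℚ (suc n)) → Linear c⁻ c c⁺ x →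
      gap q c⁻ c c⁺ x ≡ - (4ℚ * q * distℚ x c)
    gap-linear q x c⁻ c c⁺ lin = trans
      (cong (λ d → (1ℚ - q) * d - (1ℚ + q) * (distℚ x c + distℚ x c)) lin)
      (solve 2 (λ q d → (con 1ℚ :- q) :* (d :+ d) :- (con 1ℚ :+ q) :* (d :+ d)
                     := :- (con 4ℚ :* q :* d)) refl q (distℚ x c))

    -- The worst case is q = 1/2, where 1/2 · 22/48 - 3/2 · 2/48 = 1/6.
    gap-lower : ∀ {q d⁻ d d⁺ y} → 0ℚ ≤ q → q ≤ ½ → 0ℚ ≤ y →
      + 11 / 48 * y ≤ d⁻ → + 11 / 48 * y ≤ d⁺ → d ≤ + 1 / 48 * y →
      + 1 / 6 * y ≤ (1ℚ - q) * (d⁻ + d⁺) - (1ℚ + q) * (d + d)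
    gap-lower {q} {d⁻} {d} {d⁺} {y} q≥0 q≤½ y≥0 d⁻≥ d⁺≥ d≤ = ≤-by
      (*-nonNeg 1-q≥0 (⟦ d⁻≥ ⟧ ⊕ ⟦ d⁺≥ ⟧) ⊕ *-nonNeg 1+q≥0 (+ 2 / 1 ⊙ ⟦ d≤ ⟧)
        ⊕ ½ ⊙ *-nonNeg ⟦ q≤½ ⟧ y≥0)
      (solve 5 (λ q d⁻ d d⁺ y →
          (con 1ℚ :- q) :* (d⁻ :+ d⁺) :- (con 1ℚ :+ q) :* (d :+ d)
          := con (+ 1 / 6) :* y :+
            ((con 1ℚ :- q) :* ((d⁻ :- con (+ 11 / 48) :* y) :+ (d⁺ :- con (+ 11 / 48) :* y))
            :+ ((con 1ℚ :+ q) :* (con (+ 2 / 1) :* (con (+ 1 / 48) :* y :- d))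
            :+ con ½ :* ((con ½ :- q) :* y))))
        refl q d⁻ d d⁺ y)
      where
      1-q≥0 : 0ℚ ≤ 1ℚ - q
      1-q≥0 = ⟦ ℚ.≤-trans q≤½ (≤-by (ℚ.nonNegative⁻¹ ½) refl) ⟧
      1+q≥0 : 0ℚ ≤ 1ℚ + q
      1+q≥0 = ℚ.nonNegative⁻¹ 1ℚ ⊕ q≥0

-- The geometric point set.

module GeometricPoints where
  open Rational
  open import Data.Rational.Base

  -- The offset toℕ i < count only serves to make the points of a class distinct;
  -- the factor 48 in base keeps it below height / 48.
  module Geometric (t : ℕ) where
    multiplicity : Vector ℕ t
    multiplicity b = 4 ℕ.^ (t ℕ.∸ toℕ b)

    count base : ℕ
    count = size multiplicity
    base = 48 ℕ.* suc count

    height : Fin t → ℕ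
    height b = base ℕ.* 4 ℕ.^ toℕ b

    class : Fin count → Fin t
    class = level multiplicity

    position : Fin count → ℕ
    position i = toℕ i ℕ.+ height (class i)

    y : Vector ℚ t
    y b = ι (height b)

    p : Vector ℚ count
    p i = ι (position i)

    mass : ℚ
    mass = ι (base ℕ.* 4 ℕ.^ t)

    abstract
      base≤height : ∀ b → base ℕ.≤ height b
      base≤height b = ℕ.m≤m*n base (4 ℕ.^ toℕ b) {{ℕ.m^n≢0 4 (toℕ b)}}

      -- Heights are multiples of `base` and offsets are below `base`, so the remainder modulo
      -- `base` recovers the index.
      position-injective : Injective _≡_ _≡_ position
      position-injective {i} {j} eq = Fin.toℕ-injective (begin
        toℕ i              ≡⟨ position%base i ⟨
        position i % base  ≡⟨ cong (_% base) eq ⟩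
        position j % base  ≡⟨ position%base j ⟩
        toℕ j              ∎)
        where
        open ≡-Reasoning
        position%base : ∀ i → position i % base ≡ toℕ i
        position%base i = begin
          (toℕ i ℕ.+ base ℕ.* 4 ℕ.^ toℕ (class i)) % base
            ≡⟨ cong (λ h → (toℕ i ℕ.+ h) % base) (ℕ.*-comm base (4 ℕ.^ toℕ (class i))) ⟩
          (toℕ i ℕ.+ 4 ℕ.^ toℕ (class i) ℕ.* base) % base
            ≡⟨ [m+kn]%n≡m%n (toℕ i) (4 ℕ.^ toℕ (class i)) base ⟩
          toℕ i % base
            ≡⟨ m<n⇒m%n≡m (ℕ.<-≤-trans (Fin.toℕ<n i)
                 (ℕ.≤-trans (ℕ.n≤1+n count) (ℕ.m≤n*m (suc count) 48))) ⟩
          toℕ i ∎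

      p-injective : Injective _≡_ _≡_ p
      p-injective = position-injective ∘ ι-injective

      -- This makes the radius ¼ of a neighbourhood negligible against every height, so that points
      -- near `p i` stay between y/2 and 3y/2.
      48≤y : ∀ b → + 48 / 1 ≤ y b
      48≤y b = subst (_≤ y b) (ι≡/1 48)
        (ι-mono (ℕ.≤-trans (ℕ.m≤m*n 48 (suc count)) (base≤height b)))

      y-nonNeg : ∀ b → 0ℚ ≤ y b
      y-nonNeg b = ι-nonNeg (height b)

      y-pos : ∀ b → 0ℚ < y b
      y-pos b = ℚ.<-≤-trans (ℚ.positive⁻¹ (+ 48 / 1)) (48≤y b)

      y≤p : ∀ i → y (class i) ≤ p i
      y≤p i = ι-mono (ℕ.m≤n+m (height (class i)) (toℕ i))

      p≤y+ : ∀ i → p i ≤ + 49 / 48 * y (class i)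
      p≤y+ i = ≤-by (+ 1 / 48 ⊙ ⟦ 48i≤y ⟧)
        (trans (solve 2 (λ i y → con (+ 49 / 48) :* y := (i :+ y) :+
                  con (+ 1 / 48) :* (y :- con (+ 48 / 1) :* i)) refl (ι (toℕ i)) (y (class i)))
          (cong (_+ + 1 / 48 * (y (class i) - + 48 / 1 * ι (toℕ i)))
            (sym (ι-+ (toℕ i) (height (class i))))))
        where
        48i≤y : + 48 / 1 * ι (toℕ i) ≤ y (class i)
        48i≤y = subst (_≤ y (class i)) (trans (ι-* 48 (toℕ i)) (cong (_* ι (toℕ i)) (ι≡/1 48)))
          (ι-mono (ℕ.≤-trans
            (ℕ.*-monoʳ-≤ 48 (ℕ.≤-trans (ℕ.<⇒≤ (Fin.toℕ<n i)) (ℕ.n≤1+n count)))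
            (base≤height (class i))))

      y-growth : ∀ {a b} → toℕ a ℕ.< toℕ b → 4ℚ * y a ≤ y b
      y-growth {a} {b} a<b = subst (_≤ y b)
        (trans (ι-* 4 (height a)) (cong (_* y a) (ι≡/1 4)))
        (ι-mono (begin
          4 ℕ.* (base ℕ.* 4 ℕ.^ toℕ a)
            ≡⟨ ℕ.*-assoc 4 base (4 ℕ.^ toℕ a) ⟨
          4 ℕ.* base ℕ.* 4 ℕ.^ toℕ a
            ≡⟨ cong (ℕ._* 4 ℕ.^ toℕ a) (ℕ.*-comm 4 base) ⟩
          base ℕ.* 4 ℕ.* 4 ℕ.^ toℕ a
            ≡⟨ ℕ.*-assoc base 4 (4 ℕ.^ toℕ a) ⟩
          base ℕ.* 4 ℕ.^ suc (toℕ a)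
            ≤⟨ ℕ.*-monoʳ-≤ base (ℕ.^-monoʳ-≤ 4 a<b) ⟩
          base ℕ.* 4 ℕ.^ toℕ b ∎))
        where open ℕ.≤-Reasoning

      y-separated : ∀ {a b} → a ≢ b → Separated (y a) (y b)
      y-separated {a} {b} a≢b with ℕ.<-cmp (toℕ a) (toℕ b)
      ... | tri< a<b _ _ = inj₂ (y-growth a<b)
      ... | tri≈ _ a≡b _ = contradiction (Fin.toℕ-injective a≡b) a≢b
      ... | tri> _ _ b<a = inj₁ (y-growth b<a)

      4y≰y : ∀ {a b} → y a ≡ y b → ¬ 4ℚ * y a ≤ y b
      4y≰y {a} {b} eq 4y≤y = ℚ.<-irrefl refl (ℚ.<-≤-trans y<4y
        (subst (4ℚ * y a ≤_) (sym eq) 4y≤y))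
        where
        y<4y : y a < 4ℚ * y a
        y<4y = <-by (*-pos (ℚ.positive⁻¹ (+ 3 / 1)) (y-pos a))
          (solve 1 (λ y → con 4ℚ :* y := y :+ con (+ 3 / 1) :* y) refl (y a))

      y-injective : Injective _≡_ _≡_ y
      y-injective {a} {b} eq with a Fin.≟ b
      ... | yes a≡b = a≡b
      ... | no  a≢b with y-separated a≢b
      ...   | inj₁ 4b≤a = contradiction 4b≤a (4y≰y {b} {a} (sym eq))
      ...   | inj₂ 4a≤b = contradiction 4a≤b (4y≰y {a} {b} eq)

      -- The exponents t - b and b add up to t; the truncated subtraction is exact since b < t.
      multiplicity*y : ∀ b → ι (multiplicity b) * y b ≡ mass
      multiplicity*y b = trans (sym (ι-* (multiplicity b) (height b))) (cong ι (begin
        4 ℕ.^ (t ℕ.∸ toℕ b) ℕ.* (base ℕ.* 4 ℕ.^ toℕ b)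
          ≡⟨ ℕ.*-assoc (4 ℕ.^ (t ℕ.∸ toℕ b)) base (4 ℕ.^ toℕ b) ⟨
        4 ℕ.^ (t ℕ.∸ toℕ b) ℕ.* base ℕ.* 4 ℕ.^ toℕ b
          ≡⟨ cong (ℕ._* 4 ℕ.^ toℕ b) (ℕ.*-comm (4 ℕ.^ (t ℕ.∸ toℕ b)) base) ⟩
        base ℕ.* 4 ℕ.^ (t ℕ.∸ toℕ b) ℕ.* 4 ℕ.^ toℕ b
          ≡⟨ ℕ.*-assoc base (4 ℕ.^ (t ℕ.∸ toℕ b)) (4 ℕ.^ toℕ b) ⟩
        base ℕ.* (4 ℕ.^ (t ℕ.∸ toℕ b) ℕ.* 4 ℕ.^ toℕ b)
          ≡⟨ cong (base ℕ.*_) (ℕ.^-distribˡ-+-* 4 (t ℕ.∸ toℕ b) (toℕ b)) ⟨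
        base ℕ.* 4 ℕ.^ (t ℕ.∸ toℕ b ℕ.+ toℕ b)
          ≡⟨ cong (λ e → base ℕ.* 4 ℕ.^ e) (ℕ.m∸n+n≡m (ℕ.<⇒≤ (Fin.toℕ<n b))) ⟩
        base ℕ.* 4 ℕ.^ t ∎))
        where open ≡-Reasoning

      mass-pos : 0ℚ < mass
      mass-pos = ℚ.<-≤-trans (ι-suc-pos 0) (ι-mono (ℕ.*-mono-≤
        (ℕ.≤-trans (ℕ.s≤s ℕ.z≤n) (ℕ.m≤m*n 48 (suc count))) (ℕ.m^n>0 4 t)))

      near-½≤ : ∀ i {x} → ∣ x - p i ∣ ≤ ¼ → ½ * y (class i) ≤ x
      near-½≤ i {x} near = ≤-by
        (⟦ ℚ.≤-trans (c-x≤∣x-c∣ x (p i)) near ⟧ ⊕ ⟦ y≤p i ⟧ ⊕ ½ ⊙ ⟦ 48≤y (class i) ⟧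
          ⊕ ℚ.nonNegative⁻¹ (+ 95 / 4))
        (solve 3 (λ x p y → x := con ½ :* y :+ ((con ¼ :- (p :- x)) :+ ((p :- y) :+
            (con ½ :* (y :- con (+ 48 / 1)) :+ con (+ 95 / 4))))) refl x (p i) (y (class i)))

      near-≤1½ : ∀ i {x} → ∣ x - p i ∣ ≤ ¼ → x ≤ 1½ * y (class i)
      near-≤1½ i {x} near = ≤-by
        (⟦ ℚ.≤-trans (x-c≤∣x-c∣ x (p i)) near ⟧ ⊕ ⟦ p≤y+ i ⟧ ⊕ + 23 / 48 ⊙ ⟦ 48≤y (class i) ⟧
          ⊕ ℚ.nonNegative⁻¹ (+ 91 / 4))
        (solve 3 (λ x p y → con 1½ :* y := x :+ ((con ¼ :- (x :- p)) :+
            ((con (+ 49 / 48) :* y :- p) :+ (con (+ 23 / 48) :* (y :- con (+ 48 / 1))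
            :+ con (+ 91 / 4))))) refl x (p i) (y (class i)))

-- Refuting small subsets of the geometric points.

module GeometricRefutations where
  open Rational
  open Gaps
  open GeometricPoints
  open import Data.Rational.Base
  open Sum (Ring.semiring ℚ.+-*-ring) using (sum; sum-cong-≗; ∑-distrib-+; *-distribˡ-sum)

  abstract
    scale-injective : ∀ {n} {v : Vector ℚ n} μ {{_ : Positive μ}} →
      Injective _≡_ _≡_ v → Injective _≡_ _≡_ (scale μ v)
    scale-injective μ inj eq = inj (ℚ.≤-antisym
      (ℚ.*-cancelˡ-≤-pos μ (ℚ.≤-reflexive eq))
      (ℚ.*-cancelˡ-≤-pos μ (ℚ.≤-reflexive (sym eq))))

  module _ (k u : ℕ) (q : ℚ) (q>0 : 0ℚ < q) (q≤½ : q ≤ ½)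
           (k>0 : 0 ℕ.< k) (32qu≤k : + 32 / 1 * (q * ι u) ≤ ι k) where
    open Geometric (k ℕ.+ u)

    private
      -- Per unit of mass, gap is at least 1/6 on a selected class and -5q on any other.
      -- Adding 5q makes these bounds nonnegative, as sum-injective-≤ requires.
      reward : ℚ
      reward = + 1 / 6 + + 5 / 1 * q

      rewardIf : ∀ {A : Set} → Dec A → ℚ
      rewardIf (yes _) = reward
      rewardIf (no _)  = 0ℚ

      abstract
        q≥0 : 0ℚ ≤ q
        q≥0 = ℚ.<⇒≤ q>0

        reward-nonNeg : 0ℚ ≤ reward
        reward-nonNeg = ℚ.nonNegative⁻¹ (+ 1 / 6) ⊕ + 5 / 1 ⊙ q≥0

        rewardIf-nonNeg : ∀ {A : Set} (d : Dec A) → 0ℚ ≤ rewardIf d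
        rewardIf-nonNeg (yes _) = reward-nonNeg
        rewardIf-nonNeg (no _)  = ℚ.≤-refl

        rewardIf-yes : ∀ {A : Set} (d : Dec A) → A → rewardIf d ≡ reward
        rewardIf-yes (yes _) a = refl
        rewardIf-yes (no ¬a) a = contradiction a ¬a

    module _ (g : Fin k → Fin (k ℕ.+ u)) (g-injective : Injective _≡_ _≡_ g) where
      private
        selected? : ∀ b → Dec (∃[ j ] b ≡ g j)
        selected? b = Fin.any? (λ j → b Fin.≟ g j)

        v : Vector ℚ (suc k)
        v zero    = 0ℚ
        v (suc j) = y (g j)

        rate : Fin (k ℕ.+ u) → ℚ
        rate b = rewardIf (selected? b) + - (+ 5 / 1 * q)

        abstract
          v-nonNeg : ∀ j → 0ℚ ≤ v j
          v-nonNeg zero    = ℚ.≤-refl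
          v-nonNeg (suc j) = y-nonNeg (g j)

          v-injective : Injective _≡_ _≡_ v
          v-injective {zero}  {zero}  eq = refl
          v-injective {zero}  {suc j} eq = contradiction (y-pos (g j)) (ℚ.<-irrefl eq)
          v-injective {suc i} {zero}  eq = contradiction (y-pos (g i)) (ℚ.<-irrefl (sym eq))
          v-injective {suc i} {suc j} eq = cong suc (g-injective (y-injective eq))

          -- The hypothesis concerns only the class that j stands for. This serves an unselected b
          -- against all centers as well as a selected b against all centers but its own.
          v-separated : ∀ {b} j → (∀ j′ → j ≡ suc j′ → b ≢ g j′) → Separated (y b) (v j)
          v-separated {b} zero    _   = inj₁ (subst (_≤ y b) (sym (ℚ.*-zeroʳ 4ℚ)) (y-nonNeg b))
          v-separated     (suc j) b≢g = y-separated (b≢g j refl)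

        c⁻ c c⁺ : Vector ℚ (suc k)
        c⁻ = scale ¾ v
        c  = scale 1ℚ v
        c⁺ = scale 1¼ v

        abstract
          unselected-linear : ∀ i x → (∀ j → class i ≢ g j) → ∣ x - p i ∣ ≤ ¼ →
            Linear c⁻ c c⁺ x × distℚ x c ≤ x
          unselected-linear i x unsel near =
            linear-scale v v-nonNeg refl (near-½≤ i near) (near-≤1½ i near) (y-nonNeg (class i))
              (λ j → v-separated j (λ j′ _ → unsel j′))

          -- On a selected class the 5q in `rate` cancels and `gap-lower` applies. On any other the
          -- gap is -4qd with d ≤ p ≤ 49y/48, and 4 · 49/48 is rounded up to 5.
          gap-bound : ∀ i → y (class i) * rate (class i) ≤ gap q c⁻ c c⁺ (p i)
          gap-bound i with selected? (class i)
          ... | yes (j , eq) = ℚ.≤-trans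
            (≤-by ℚ.≤-refl (solve 2 (λ q y → con (+ 1 / 6) :* y
                := y :* ((con (+ 1 / 6) :+ con (+ 5 / 1) :* q) :+ :- (con (+ 5 / 1) :* q)) :+ con 0ℚ)
              refl q (y (class i))))
            (gap-lower q≥0 q≤½ (y-nonNeg (class i))
              (distℚ-selected-¾ v v-nonNeg (y≤p i) (p≤y+ i) (y-nonNeg (class i)) (suc j) vj≡ sep)
              (distℚ-selected-1¼ v v-nonNeg (y≤p i) (p≤y+ i) (y-nonNeg (class i)) (suc j) vj≡ sep)
              (distℚ-selected v v-nonNeg (y≤p i) (p≤y+ i) (y-nonNeg (class i)) (suc j) vj≡ sep))
            where
            vj≡ : v (suc j) ≡ y (class i)
            vj≡ = cong y (sym eq)
            sep : ∀ j′ → j′ ≢ suc j → Separated (y (class i)) (v j′)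
            sep j′ j′≢ = v-separated j′ λ l j′≡ class≡ →
              j′≢ (trans j′≡ (cong suc (g-injective (trans (sym class≡) eq))))
          ... | no unsel = subst (y (class i) * (0ℚ + - (+ 5 / 1 * q)) ≤_)
              (sym (gap-linear q (p i) c⁻ c c⁺ lin))
              (≤-by (*-nonNeg q≥0 (4ℚ ⊙ ⟦ d≤x ⟧ ⊕ 4ℚ ⊙ ⟦ p≤y+ i ⟧ ⊕ + 11 / 12 ⊙ y-nonNeg (class i)))
                (solve 4 (λ q y p d → :- (con 4ℚ :* q :* d) :=
                    y :* (con 0ℚ :+ :- (con (+ 5 / 1) :* q)) :+
                      q :* (con 4ℚ :* (p :- d) :+ (con 4ℚ :* (con (+ 49 / 48) :* y :- p)
                        :+ con (+ 11 / 12) :* y)))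
                  refl q (y (class i)) (p i) (distℚ (p i) c)))
            where
            near : ∣ p i - p i ∣ ≤ ¼
            near = ℚ.≤-trans (ℚ.≤-reflexive (cong ∣_∣ (ℚ.+-inverseʳ (p i)))) (ℚ.nonNegative⁻¹ ¼)
            lin : Linear c⁻ c c⁺ (p i)
            lin = proj₁ (unselected-linear i (p i) (λ j eq → unsel (j , eq)) near)
            d≤x : distℚ (p i) c ≤ p i
            d≤x = proj₂ (unselected-linear i (p i) (λ j eq → unsel (j , eq)) near)

          -- The sum is at least k(1/6 + 5q) - 5q(k + u) = k/6 - 5qu, and 32qu ≤ k bounds this below
          -- by k/6 - 5k/32 = k/96.
          sum-rate : 0ℚ < sum rate
          sum-rate = ℚ.<-≤-trans (*-pos (ℚ.positive⁻¹ (+ 1 / 96)) ιk>0) (begin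
            + 1 / 96 * ι k
              ≤⟨ ≤-by (+ 5 / 32 ⊙ ⟦ 32qu≤k ⟧) (solve 3 (λ q k u →
                   k :* (con (+ 1 / 6) :+ con (+ 5 / 1) :* q) :+ (k :+ u) :* (:- (con (+ 5 / 1) :* q))
                   := con (+ 1 / 96) :* k :+ con (+ 5 / 32) :* (k :- con (+ 32 / 1) :* (q :* u)))
                   refl q (ι k) (ι u)) ⟩
            ι k * reward + (ι k + ι u) * - (+ 5 / 1 * q)
              ≡⟨ cong₂ _+_ (trans (sym (sum-const k reward))
                     (sum-cong-≗ λ j → sym (rewardIf-yes (selected? (g j)) (j , refl))))
                   (trans (cong (_* - (+ 5 / 1 * q)) (sym (ι-+ k u)))
                     (sym (sum-const (k ℕ.+ u) (- (+ 5 / 1 * q))))) ⟩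
            sum (rewardIf ∘ selected? ∘ g) + sum {k ℕ.+ u} (λ _ → - (+ 5 / 1 * q))
              ≤⟨ ℚ.+-monoˡ-≤ _ (sum-injective-≤ g (rewardIf-nonNeg ∘ selected?) g-injective) ⟩
            sum (λ b → rewardIf (selected? b)) + sum {k ℕ.+ u} (λ _ → - (+ 5 / 1 * q))
              ≡⟨ ∑-distrib-+ (λ b → rewardIf (selected? b)) (λ _ → - (+ 5 / 1 * q)) ⟨
            sum rate ∎)
            where
            open ℚ.≤-Reasoning
            ιk>0 : 0ℚ < ι k
            ιk>0 = ℚ.<-≤-trans (ι-suc-pos 0) (ι-mono k>0)

          -- Grouping the points by class pulls out the common factor `mass` and leaves the sum of
          -- the rates.
          sum-gap : 0ℚ < sum (gap q c⁻ c c⁺ ∘ p)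
          sum-gap = ℚ.<-≤-trans (*-pos mass-pos sum-rate) (begin
            mass * sum rate
              ≡⟨ *-distribˡ-sum mass rate ⟩
            sum (λ b → mass * rate b)
              ≡⟨ sum-cong-≗ (λ b → trans (cong (_* rate b) (sym (multiplicity*y b)))
                   (ℚ.*-assoc (ι (multiplicity b)) (y b) (rate b))) ⟩
            sum (λ b → ι (multiplicity b) * (y b * rate b))
              ≡⟨ sum-level multiplicity (λ b → y b * rate b) ⟨
            sum (λ i → y (class i) * rate (class i))
              ≤⟨ sum-mono gap-bound ⟩
            sum (gap q c⁻ c c⁺ ∘ p) ∎)
            where open ℚ.≤-Reasoning

      geometric-refutation′ : ∀ {s} (f : Fin s → Fin count) → (∀ i j → class (f i) ≢ g j) →
        Refutation k q p f
      geometric-refutation′ f unhit = record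
        { c⁻ = c⁻
        ; c  = c
        ; c⁺ = c⁺
        ; c⁻-injective = scale-injective ¾ v-injective
        ; c-injective  = scale-injective 1ℚ v-injective
        ; c⁺-injective = scale-injective 1¼ v-injective
        ; linear = λ i x near → proj₁ (unselected-linear (f i) x (unhit i) near)
        ; gap-pos = sum-gap
        }

    geometric-refutation : ∀ {s} (f : Fin s → Fin count) → s ℕ.≤ u → Refutation k q p f
    geometric-refutation {s} f s≤u =
      let g , g-injective , unhit = avoid k (class ∘ f)
            (subst (s ℕ.+ k ℕ.≤_) (ℕ.+-comm u k) (ℕ.+-monoˡ-≤ k s≤u))
      in geometric-refutation′ g g-injective f unhit

-- Refuting subsets that miss an integer point.

module IntegerRefutations where
  open Rational
  open Gaps
  open import Data.Rational.Base
  open Sum (Ring.semiring ℚ.+-*-ring) using (sum)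

  module _ {k s : ℕ} (q : ℚ) (q<1 : q < 1ℚ) (f : Fin s → Fin (suc k))
           (i₀ : Fin (suc k)) (unhit : ∀ i → f i ≢ i₀) where
    private
      p : Vector ℚ (suc k)
      p i = ι (toℕ i)

      shiftIf : ∀ {A : Set} → Dec A → ℚ → ℚ
      shiftIf (yes _) σ = σ
      shiftIf (no _)  σ = 0ℚ

      center : ℚ → Vector ℚ (suc k)
      center σ j = p j + shiftIf (j Fin.≟ i₀) σ

      c⁻ c c⁺ : Vector ℚ (suc k)
      c⁻ = center (- ¼)
      c  = center 0ℚ
      c⁺ = center ¼

      abstract
        gap-1 : ∀ {i j} → i ≢ j → 1ℚ + p i ≤ p j ⊎ 1ℚ + p j ≤ p i
        gap-1 {i} {j} i≢j with ℕ.<-cmp (toℕ i) (toℕ j)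
        ... | tri< i<j _ _ = inj₁ (1+ι≤ i<j)
        ... | tri≈ _ i≡j _ = contradiction (Fin.toℕ-injective i≡j) i≢j
        ... | tri> _ _ j<i = inj₂ (1+ι≤ j<i)

        shiftIf-≤ : ∀ {A : Set} (d : Dec A) {σ} → σ ≤ ¼ → shiftIf d σ ≤ ¼
        shiftIf-≤ (yes _) σ≤¼ = σ≤¼
        shiftIf-≤ (no _)  _   = ℚ.nonNegative⁻¹ ¼

        shiftIf-≥ : ∀ {A : Set} (d : Dec A) {σ} → - ¼ ≤ σ → - ¼ ≤ shiftIf d σ
        shiftIf-≥ (yes _) -¼≤σ = -¼≤σ
        shiftIf-≥ (no _)  _    = ℚ.nonPositive⁻¹ (- ¼)

        center-i₀ : ∀ σ → center σ i₀ ≡ p i₀ + σ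
        center-i₀ σ with i₀ Fin.≟ i₀
        ... | yes _ = refl
        ... | no ≢  = contradiction refl ≢

        center-≢ : ∀ σ {i} → i ≢ i₀ → center σ i ≡ p i
        center-≢ σ {i} i≢i₀ with i Fin.≟ i₀
        ... | yes eq = contradiction eq i≢i₀
        ... | no _   = ℚ.+-identityʳ (p i)

        module _ {σ} (-¼≤σ : - ¼ ≤ σ) (σ≤¼ : σ ≤ ¼) where
          -- Distinct integers are at least 1 apart, and x and the center each move by at most 1/4.
          center-far : ∀ x {a j} → ∣ x - p a ∣ ≤ ¼ → a ≢ j → ½ ≤ ∣ x - center σ j ∣
          center-far x {a} {j} near a≢j with gap-1 a≢j
          ... | inj₁ h = ℚ.≤-trans
            (≤-by (⟦ h ⟧ ⊕ ⟦ ℚ.≤-trans (x-c≤∣x-c∣ x (p a)) near ⟧ ⊕ ⟦ shiftIf-≥ (j Fin.≟ i₀) -¼≤σ ⟧)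
              (solve 4 (λ x a j t → (j :+ t) :- x := con ½ :+ ((j :- (con 1ℚ :+ a)) :+
                  ((con ¼ :- (x :- a)) :+ (t :- :- con ¼))))
                refl x (p a) (p j) (shiftIf (j Fin.≟ i₀) σ)))
            (c-x≤∣x-c∣ x (center σ j))
          ... | inj₂ h = ℚ.≤-trans
            (≤-by (⟦ h ⟧ ⊕ ⟦ ℚ.≤-trans (c-x≤∣x-c∣ x (p a)) near ⟧ ⊕ ⟦ shiftIf-≤ (j Fin.≟ i₀) σ≤¼ ⟧)
              (solve 4 (λ x a j t → x :- (j :+ t) := con ½ :+ ((a :- (con 1ℚ :+ j)) :+
                  ((con ¼ :- (a :- x)) :+ (con ¼ :- t))))
                refl x (p a) (p j) (shiftIf (j Fin.≟ i₀) σ)))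
            (x-c≤∣x-c∣ x (center σ j))

          distℚ-unmoved : ∀ x {a} → ∣ x - p a ∣ ≤ ¼ → a ≢ i₀ → distℚ x (center σ) ≡ ∣ x - p a ∣
          distℚ-unmoved x {a} near a≢i₀ =
            trans (minimumℚ-≡ (λ j → ∣ x - center σ j ∣) a least) eq
            where
            eq : ∣ x - center σ a ∣ ≡ ∣ x - p a ∣
            eq = cong (λ b → ∣ x - b ∣) (center-≢ σ a≢i₀)
            least : ∀ j → ∣ x - center σ a ∣ ≤ ∣ x - center σ j ∣
            least j with a Fin.≟ j
            ... | yes refl = ℚ.≤-refl
            ... | no a≢j = ℚ.≤-trans (subst (_≤ ½) (sym eq)
              (ℚ.≤-trans near (≤-by (ℚ.nonNegative⁻¹ ¼) refl))) (center-far x near a≢j)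

          near-self : ∀ a → ∣ p a - p a ∣ ≤ ¼
          near-self a = ℚ.≤-trans (ℚ.≤-reflexive (cong ∣_∣ (ℚ.+-inverseʳ (p a)))) (ℚ.nonNegative⁻¹ ¼)

          -- Center i lies within 1/4 of `p i`, so `center-far` keeps it at least 1/2 away from
          -- every other center.
          center-injective : Injective _≡_ _≡_ (center σ)
          center-injective {i} {j} eq with i Fin.≟ j
          ... | yes i≡j = i≡j
          ... | no  i≢j = contradiction
            (ℚ.≤-trans (center-far′ i≢j)
              (ℚ.≤-reflexive (cong ∣_∣ (trans (cong (_- center σ j) eq) (ℚ.+-inverseʳ (center σ j))))))
            λ ½≤0 → ℚ.<-irrefl refl (ℚ.<-≤-trans (ℚ.positive⁻¹ ½) ½≤0)
            where
            near : ∣ center σ i - p i ∣ ≤ ¼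
            near = ∣∣-lub
              (subst (_≤ ¼) (solve 2 (λ p t → t := (p :+ t) :- p) refl (p i) t)
                (shiftIf-≤ (i Fin.≟ i₀) σ≤¼))
              (≤-by ⟦ shiftIf-≥ (i Fin.≟ i₀) -¼≤σ ⟧
                (solve 2 (λ p t → con ¼ := :- ((p :+ t) :- p) :+ (t :- :- con ¼)) refl (p i) t))
              where
              t : ℚ
              t = shiftIf (i Fin.≟ i₀) σ
            center-far′ : i ≢ j → ½ ≤ ∣ center σ i - center σ j ∣
            center-far′ = center-far (center σ i) near

          distℚ-moved : ∀ {b} → b ≤ ∣ σ ∣ → b ≤ ½ → b ≤ distℚ (p i₀) (center σ)
          distℚ-moved {b} b≤σ b≤½ = minimumℚ-glb (λ j → ∣ p i₀ - center σ j ∣) bound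
            where
            bound : ∀ j → b ≤ ∣ p i₀ - center σ j ∣
            bound j with i₀ Fin.≟ j
            ... | no i₀≢j  = ℚ.≤-trans b≤½ (center-far (p i₀) (near-self i₀) i₀≢j)
            ... | yes refl = subst (b ≤_) (sym (trans
              (cong ∣_∣ (trans (cong (λ a → p i₀ - a) (center-i₀ σ))
                (solve 2 (λ p t → p :- (p :+ t) := :- t) refl (p i₀) σ)))
              (ℚ.∣-p∣≡∣p∣ σ))) b≤σ

        -¼≤-¼ : - ¼ ≤ - ¼
        -¼≤-¼ = ℚ.≤-refl
        -¼≤¼ : - ¼ ≤ ¼
        -¼≤¼ = ≤-by (ℚ.nonNegative⁻¹ ½) refl
        -¼≤0 : - ¼ ≤ 0ℚ
        -¼≤0 = ℚ.nonPositive⁻¹ (- ¼)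
        0≤¼ : 0ℚ ≤ ¼
        0≤¼ = ℚ.nonNegative⁻¹ ¼
        ¼≤½ : ¼ ≤ ½
        ¼≤½ = ≤-by 0≤¼ refl

        -- The own center of x stays in place and remains the nearest, so all three distances
        -- coincide.
        unmoved-linear : ∀ x {a} → ∣ x - p a ∣ ≤ ¼ → a ≢ i₀ → Linear c⁻ c c⁺ x
        unmoved-linear x near a≢i₀ = trans
          (cong₂ _+_ (distℚ-unmoved -¼≤-¼ -¼≤¼ x near a≢i₀) (distℚ-unmoved -¼≤¼ ℚ.≤-refl x near a≢i₀))
          (sym (cong₂ _+_ (distℚ-unmoved -¼≤0 0≤¼ x near a≢i₀) (distℚ-unmoved -¼≤0 0≤¼ x near a≢i₀)))

        distℚ-self : ∀ a → distℚ (p a) c ≡ 0ℚ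
        distℚ-self a = ℚ.≤-antisym
          (ℚ.≤-trans (minimumℚ-≤ (λ j → ∣ p a - c j ∣) a)
            (ℚ.≤-reflexive (cong ∣_∣ (trans (cong (λ b → p a - (p a + b)) (shift0 (a Fin.≟ i₀)))
              (solve 1 (λ p → p :- (p :+ con 0ℚ) := con 0ℚ) refl (p a))))))
          (distℚ-nonNeg (p a) c)
          where
          shift0 : ∀ {A : Set} (d : Dec A) → shiftIf d 0ℚ ≡ 0ℚ
          shift0 (yes _) = refl
          shift0 (no _)  = refl

        gap-unmoved : ∀ a → a ≢ i₀ → gap q c⁻ c c⁺ (p a) ≡ 0ℚ
        gap-unmoved a a≢i₀ = trans
          (gap-linear q (p a) c⁻ c c⁺ (unmoved-linear (p a) (near-self -¼≤0 0≤¼ a) a≢i₀))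
          (trans (cong (λ d → - (4ℚ * q * d)) (distℚ-self a))
            (solve 1 (λ q → :- (con 4ℚ :* q :* con 0ℚ) := con 0ℚ) refl q))

        -- Here d = 0 while both perturbed distances are at least 1/4. This leaves (1 - q)/2, which
        -- is positive because q < 1.
        gap-i₀ : 0ℚ < gap q c⁻ c c⁺ (p i₀)
        gap-i₀ = ℚ.<-≤-trans (*-pos (ℚ.positive⁻¹ ½) 0<1-q)
          (subst (λ d → ½ * (1ℚ - q) ≤ (1ℚ - q) * (d⁻ + d⁺) - (1ℚ + q) * (d + d))
            (sym (distℚ-self i₀))
            (≤-by (*-nonNeg (ℚ.<⇒≤ 0<1-q)
                (⟦ distℚ-moved -¼≤-¼ -¼≤¼ ℚ.≤-refl ¼≤½ ⟧ ⊕ ⟦ distℚ-moved -¼≤¼ ℚ.≤-refl ℚ.≤-refl ¼≤½ ⟧))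
              (solve 3 (λ q d⁻ d⁺ → (con 1ℚ :- q) :* (d⁻ :+ d⁺) :- (con 1ℚ :+ q) :* (con 0ℚ :+ con 0ℚ)
                  := con ½ :* (con 1ℚ :- q) :+ (con 1ℚ :- q) :* ((d⁻ :- con ¼) :+ (d⁺ :- con ¼)))
                refl q d⁻ d⁺)))
          where
          d⁻ d⁺ : ℚ
          d⁻ = distℚ (p i₀) c⁻
          d⁺ = distℚ (p i₀) c⁺
          0<1-q : 0ℚ < 1ℚ - q
          0<1-q = subst (_< 1ℚ - q) (ℚ.+-inverseʳ q) (ℚ.+-monoˡ-< (- q) q<1)

        sum-gap : 0ℚ < sum (gap q c⁻ c c⁺ ∘ p)
        sum-gap = ℚ.<-≤-trans gap-i₀ (subst (_≤ sum (gap q c⁻ c c⁺ ∘ p))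
          (ℚ.+-identityʳ (gap q c⁻ c c⁺ (p i₀)))
          -- All terms are nonnegative, so the sum is at least its term at `i₀`, taken as a sum over
          -- `Fin 1`.
          (sum-injective-≤ {1} (λ _ → i₀) gap-nonNeg const-injective))
          where
          const-injective : Injective _≡_ _≡_ (λ (_ : Fin 1) → i₀)
          const-injective {zero} {zero} _ = refl
          gap-nonNeg : ∀ a → 0ℚ ≤ gap q c⁻ c c⁺ (p a)
          gap-nonNeg a with a Fin.≟ i₀
          ... | yes refl = ℚ.<⇒≤ gap-i₀
          ... | no a≢i₀  = ℚ.≤-reflexive (sym (gap-unmoved a a≢i₀))

    integer-refutation : Refutation k q (ι ∘ toℕ) f
    integer-refutation = record
      { c⁻ = c⁻
      ; c  = c
      ; c⁺ = c⁺
      ; c⁻-injective = center-injective -¼≤-¼ -¼≤¼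
      ; c-injective  = center-injective -¼≤0 0≤¼
      ; c⁺-injective = center-injective -¼≤¼ ℚ.≤-refl
      ; linear = λ i x near → unmoved-linear x near (unhit i)
      ; gap-pos = sum-gap
      }

  -- Archimedean property and integer quotients.

  abstract
    -- The denominator is at least 1, so dividing by it cannot increase a nonnegative numerator.
    p≤ι∣↥p∣ : ∀ p → p ≤ ι ℤ.∣ ↥ p ∣
    p≤ι∣↥p∣ p@(mkℚ (+ n) d c) = subst (p ≤_)
      (sym (trans (ι≡/1 n) (ℚ.normalize-coprime (ι-coprime n))))
      (*≤* (ℤ.*-monoˡ-≤-nonNeg (+ n) (ℤ.+≤+ (ℕ.s≤s ℕ.z≤n))))
    p≤ι∣↥p∣ p@(mkℚ ℤ.-[1+ n ] d c) =
      ℚ.≤-trans (ℚ.nonPositive⁻¹ p) (ι-nonNeg ℤ.∣ ↥ p ∣)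

    archimedean : ∀ {r} → 0ℚ < r → ∀ a → ∃[ m ] a ≤ r * ι m
    archimedean {r} r>0 a = ℤ.∣ ↥ z ∣ , (begin
      a                  ≡⟨ ℚ.*-identityˡ a ⟨
      1ℚ * a             ≡⟨ cong (_* a) (ℚ.*-inverseʳ r) ⟨
      r * 1/ r * a       ≡⟨ ℚ.*-assoc r (1/ r) a ⟩
      r * z              ≤⟨ ℚ.*-monoˡ-≤-nonNeg r {{nonNegative (ℚ.<⇒≤ r>0)}} (p≤ι∣↥p∣ z) ⟩
      r * ι ℤ.∣ ↥ z ∣    ∎)
      where
      open ℚ.≤-Reasoning
      instance
        r≢0 : NonZero r
        r≢0 = ℚ.pos⇒nonZero r {{positive r>0}}
      z : ℚ
      z = 1/ r * a

    -- Search downwards from the archimedean bound for the last m at which `r * ι m` still reaches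
    -- a.
    quotient : ∀ {r} → 0ℚ < r → ∀ {a} → 0ℚ ≤ a → ∃[ u ] r * ι u ≤ a × a ≤ r * ι (suc u)
    quotient {r} r>0 {a} a≥0 = let m , a≤ = archimedean r>0 a in search m a≤
      where
      search : ∀ m → a ≤ r * ι m → ∃[ u ] r * ι u ≤ a × a ≤ r * ι (suc u)
      search zero a≤0 = 0
        , subst (_≤ a) (sym (trans (cong (r *_) ι0≡0) (ℚ.*-zeroʳ r))) a≥0
        , ℚ.≤-trans a≤0 (ℚ.*-monoˡ-≤-nonNeg r {{nonNegative (ℚ.<⇒≤ r>0)}} (ι-mono ℕ.z≤n))
      search (suc m) a≤ with a ℚ.≤? r * ι m
      ... | yes a≤′ = search m a≤′
      ... | no  a≰  = m , ℚ.<⇒≤ (ℚ.≰⇒> a≰) , a≤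

open Rational
open Gaps
open GeometricPoints
open GeometricRefutations
open IntegerRefutations
open import Defs

module Σℚ = Sum (Ring.semiring ℚ.+-*-ring)

-- Properties holding at all late indices, and rational points as reals.

Eventually : (ℕ → Set) → Set
Eventually Q = ∃[ N ] ∀ n → N ℕ.≤ n → Q n

abstract
  _⊗_ : ∀ {P Q} → Eventually P → Eventually Q → Eventually (λ n → P n × Q n)
  (N , hP) ⊗ (M , hQ) = N ℕ.⊔ M , λ n n≥ →
    hP n (ℕ.m⊔n≤o⇒m≤o N M n≥) , hQ n (ℕ.m⊔n≤o⇒n≤o N M n≥)

  eventually-∀ : ∀ {s} {Q : Fin s → ℕ → Set} →
    (∀ i → Eventually (Q i)) → Eventually (λ n → ∀ i → Q i n)
  eventually-∀ {zero}  h = 0 , λ _ _ ()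
  eventually-∀ {suc s} h =
    let N , hN = h zero ⊗ eventually-∀ (h ∘ suc) in
    N , λ n n≥N → λ where
      zero    → proj₁ (hN n n≥N)
      (suc i) → proj₂ (hN n n≥N) i

  fromℚ-injective : Injective _≡_ _≃_ fromℚ
  fromℚ-injective {a} {b} a≃b = ℚ.≤-antisym (≤-limit a≤b+δ) (≤-limit b≤a+δ)
    where
    ∣a-b∣≤ : ∀ δ → 0ℚ ℚ.< δ → ℚ.∣ a ℚ.- b ∣ ℚ.≤ δ
    ∣a-b∣≤ δ δ>0 = let N , h = a≃b δ δ>0 in h N ℕ.≤-refl
    a≤b+δ : ∀ δ → 0ℚ ℚ.< δ → a ℚ.≤ b ℚ.+ δ
    a≤b+δ δ δ>0 = ≤-by ⟦ ℚ.≤-trans (x-c≤∣x-c∣ a b) (∣a-b∣≤ δ δ>0) ⟧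
      (solve 3 (λ a b d → b :+ d := a :+ (d :- (a :- b))) refl a b δ)
    b≤a+δ : ∀ δ → 0ℚ ℚ.< δ → b ℚ.≤ a ℚ.+ δ
    b≤a+δ δ δ>0 = ≤-by ⟦ ℚ.≤-trans (c-x≤∣x-c∣ a b) (∣a-b∣≤ δ δ>0) ⟧
      (solve 3 (λ a b d → a :+ d := b :+ (d :- (b :- a))) refl a b δ)

embed : ∀ {n} (v : Vector ℚ n) → Injective _≡_ _≡_ v → FiniteSubset n
embed v inj = record { point = fromℚ ∘ v ; distinct = inj ∘ fromℚ-injective }

-- A rational q eventually above ε replaces it: P is chosen from q alone, and the bound s ≥ k/(64q)
-- is stated without division.
ForcesSize : ℕ → ℚ → Set
ForcesSize k q = ∃[ n ] Σ[ P ∈ FiniteSubset n ]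
  (∀ s ε (S : FiniteSubset s) → Eventually (λ m → seq ε m ℚ.≤ q) → IsCoreset k ε P S →
    ι k ℚ.≤ + 64 ℚ./ 1 ℚ.* (q ℚ.* ι s))

-- Costs at a single index of the Cauchy sequences.

costℚ : ∀ {n k} → Vector ℚ n → Vector ℚ (suc k) → ℚ
costℚ x c = Σℚ.sum (λ i → distℚ (x i) c)

weightedCostℚ : ∀ {s k} → Vector ℚ s → Vector ℚ s → Vector ℚ (suc k) → ℚ
weightedCostℚ ω x c = Σℚ.sum (λ i → ω i ℚ.* distℚ (x i) c)

abstract
  seq-sum : ∀ {m} (v : Vector ℝ m) n → seq (sum v) n ≡ Σℚ.sum (λ i → seq (v i) n)
  seq-sum {zero}  v n = refl
  seq-sum {suc m} v n = cong (seq (v zero) n ℚ.+_) (seq-sum (v ∘ suc) n)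

  seq-foldr-⊓ : ∀ {m} z (v : Vector ℝ m) n →
    seq (foldr _⊓_ z v) n ≡ foldr ℚ._⊓_ (seq z n) (λ j → seq (v j) n)
  seq-foldr-⊓ {zero}  z v n = refl
  seq-foldr-⊓ {suc m} z v n = cong (seq (v zero) n ℚ.⊓_) (seq-foldr-⊓ z (v ∘ suc) n)

  seq-minimum : ∀ {m} (v : Vector ℝ (suc m)) n →
    seq (minimum v) n ≡ minimumℚ (λ j → seq (v j) n)
  seq-minimum v = seq-foldr-⊓ (head v) (tail v)

  seq-dist : ∀ {k} x (C : FiniteSubset (suc k)) n →
    seq (dist x C) n ≡ distℚ (seq x n) (λ j → seq (point C j) n)
  seq-dist x C n = seq-minimum (λ j → ∣ x - point C j ∣) n

  seq-cost : ∀ {m k} (P : FiniteSubset m) (C : FiniteSubset (suc k)) n →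
    seq (cost P C) n ≡ costℚ (λ i → seq (point P i) n) (λ j → seq (point C j) n)
  seq-cost P C n = trans (seq-sum (λ i → dist (point P i) C) n)
    (Σℚ.sum-cong-≗ λ i → seq-dist (point P i) C n)

  seq-weightedCost : ∀ {s k} (S : FiniteSubset s) w (C : FiniteSubset (suc k)) n →
    seq (weightedCost S w C) n ≡
    weightedCostℚ (λ i → seq (w i) n) (λ i → seq (point S i) n) (λ j → seq (point C j) n)
  seq-weightedCost S w C n = trans (seq-sum (λ i → w i * dist (point S i) C) n)
    (Σℚ.sum-cong-≗ λ i → cong (seq (w i) n ℚ.*_) (seq-dist (point S i) C n))

  module _ {m s k} {P : FiniteSubset m} (S : FiniteSubset s) (w : Vector ℝ s)
           (C : FiniteSubset (suc k)) (ε : ℝ) {δ : ℚ} (δ>0 : 0ℚ ℚ.< δ) where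
    private
      costₙ weightedCostₙ : ℕ → ℚ
      costₙ n = costℚ (λ i → seq (point P i) n) (λ j → seq (point C j) n)
      weightedCostₙ n = weightedCostℚ (λ i → seq (w i) n) (λ i → seq (point S i) n) (λ j → seq (point C j) n)

    eventually-lower : (1ℝ - ε) * cost P C ≤ weightedCost S w C →
      Eventually (λ n → (1ℚ ℚ.- seq ε n) ℚ.* costₙ n ℚ.≤ weightedCostₙ n ℚ.+ δ)
    eventually-lower h = let N , hN = h δ δ>0 in N , λ n N≤n →
      subst₂ (λ a b → (1ℚ ℚ.- seq ε n) ℚ.* a ℚ.≤ b ℚ.+ δ)
        (seq-cost P C n) (seq-weightedCost S w C n) (hN n N≤n)

    eventually-upper : weightedCost S w C ≤ (1ℝ + ε) * cost P C →
      Eventually (λ n → weightedCostₙ n ℚ.≤ (1ℚ ℚ.+ seq ε n) ℚ.* costₙ n ℚ.+ δ)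
    eventually-upper h = let N , hN = h δ δ>0 in N , λ n N≤n →
      subst₂ (λ a b → b ℚ.≤ (1ℚ ℚ.+ seq ε n) ℚ.* a ℚ.+ δ)
        (seq-cost P C n) (seq-weightedCost S w C n) (hN n N≤n)

  sum-combination : ∀ {n} a b (u v w : Vector ℚ n) →
    Σℚ.sum (λ i → a ℚ.* (u i ℚ.+ w i) ℚ.- b ℚ.* (v i ℚ.+ v i)) ≡
    a ℚ.* (Σℚ.sum u ℚ.+ Σℚ.sum w) ℚ.- b ℚ.* (Σℚ.sum v ℚ.+ Σℚ.sum v)
  sum-combination {zero}  a b u v w =
    solve 2 (λ a b → con 0ℚ := a :* (con 0ℚ :+ con 0ℚ) :- b :* (con 0ℚ :+ con 0ℚ)) refl a b
  sum-combination {suc n} a b u v w = trans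
    (cong (a ℚ.* (u zero ℚ.+ w zero) ℚ.- b ℚ.* (v zero ℚ.+ v zero) ℚ.+_)
      (sum-combination a b (u ∘ suc) (v ∘ suc) (w ∘ suc)))
    (solve 8 (λ a b u v w U V W →
        (a :* (u :+ w) :- b :* (v :+ v)) :+ (a :* (U :+ W) :- b :* (V :+ V))
        := a :* ((u :+ U) :+ (w :+ W)) :- b :* ((v :+ V) :+ (v :+ V)))
      refl a b (u zero) (v zero) (w zero)
      (Σℚ.sum (u ∘ suc)) (Σℚ.sum (v ∘ suc)) (Σℚ.sum (w ∘ suc)))

  weighted-linear : ∀ {s k} (ω x : Vector ℚ s) (c⁻ c c⁺ : Vector ℚ (suc k)) →
    (∀ i → Linear c⁻ c c⁺ (x i)) →
    weightedCostℚ ω x c⁻ ℚ.+ weightedCostℚ ω x c⁺ ≡ weightedCostℚ ω x c ℚ.+ weightedCostℚ ω x c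
  weighted-linear ω x c⁻ c c⁺ lin = trans
    (sym (Σℚ.∑-distrib-+ (λ i → ω i ℚ.* distℚ (x i) c⁻) (λ i → ω i ℚ.* distℚ (x i) c⁺)))
    (trans (Σℚ.sum-cong-≗ λ i →
        trans (sym (ℚ.*-distribˡ-+ (ω i) (distℚ (x i) c⁻) (distℚ (x i) c⁺)))
          (trans (cong (ω i ℚ.*_) (lin i)) (ℚ.*-distribˡ-+ (ω i) (distℚ (x i) c) (distℚ (x i) c))))
      (Σℚ.∑-distrib-+ (λ i → ω i ℚ.* distℚ (x i) c) (λ i → ω i ℚ.* distℚ (x i) c)))

  -- Adding both lower bounds and twice the upper bound eliminates the weighted costs and collects
  -- 4δ. Passing from ε to the larger q lowers the left side, since the costs are nonnegative.
  gap-small : ∀ q ε f⁻ f f⁺ w⁻ w w⁺ δ →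
    ε ℚ.≤ q → 0ℚ ℚ.≤ f⁻ → 0ℚ ℚ.≤ f → 0ℚ ℚ.≤ f⁺ → w⁻ ℚ.+ w⁺ ≡ w ℚ.+ w →
    (1ℚ ℚ.- ε) ℚ.* f⁻ ℚ.≤ w⁻ ℚ.+ δ → (1ℚ ℚ.- ε) ℚ.* f⁺ ℚ.≤ w⁺ ℚ.+ δ →
    w ℚ.≤ (1ℚ ℚ.+ ε) ℚ.* f ℚ.+ δ →
    (1ℚ ℚ.- q) ℚ.* (f⁻ ℚ.+ f⁺) ℚ.- (1ℚ ℚ.+ q) ℚ.* (f ℚ.+ f) ℚ.≤ 4ℚ ℚ.* δ
  gap-small q ε f⁻ f f⁺ w⁻ w w⁺ δ ε≤q f⁻≥0 f≥0 f⁺≥0 eq h⁻ h⁺ h = ≤-by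
    (⟦ h⁻ ⟧ ⊕ ⟦ h⁺ ⟧ ⊕ ⟦ ℚ.≤-reflexive eq ⟧ ⊕ + 2 ℚ./ 1 ⊙ ⟦ h ⟧
      ⊕ *-nonNeg ⟦ ε≤q ⟧ (f⁻≥0 ⊕ f⁺≥0 ⊕ + 2 ℚ./ 1 ⊙ f≥0))
    (solve 9 (λ q e f⁻ f f⁺ w⁻ w w⁺ d →
        con 4ℚ :* d := ((con 1ℚ :- q) :* (f⁻ :+ f⁺) :- (con 1ℚ :+ q) :* (f :+ f)) :+
          (((w⁻ :+ d) :- (con 1ℚ :- e) :* f⁻) :+ (((w⁺ :+ d) :- (con 1ℚ :- e) :* f⁺) :+
            (((w :+ w) :- (w⁻ :+ w⁺)) :+ (con (+ 2 ℚ./ 1) :* (((con 1ℚ :+ e) :* f :+ d) :- w) :+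
              (q :- e) :* (f⁻ :+ (f⁺ :+ con (+ 2 ℚ./ 1) :* f)))))))
      refl q ε f⁻ f f⁺ w⁻ w w⁺ δ)

  total-gap-small : ∀ {n s k q ε δ} (p : Vector ℚ n) (ω x : Vector ℚ s) (c⁻ c c⁺ : Vector ℚ (suc k)) →
    ε ℚ.≤ q → (∀ i → Linear c⁻ c c⁺ (x i)) →
    (1ℚ ℚ.- ε) ℚ.* costℚ p c⁻ ℚ.≤ weightedCostℚ ω x c⁻ ℚ.+ δ →
    (1ℚ ℚ.- ε) ℚ.* costℚ p c⁺ ℚ.≤ weightedCostℚ ω x c⁺ ℚ.+ δ →
    weightedCostℚ ω x c ℚ.≤ (1ℚ ℚ.+ ε) ℚ.* costℚ p c ℚ.+ δ →
    Σℚ.sum (gap q c⁻ c c⁺ ∘ p) ℚ.≤ 4ℚ ℚ.* δ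
  total-gap-small {k = k} {q} {ε} {δ} p ω x c⁻ c c⁺ ε≤q lin h⁻ h⁺ h = subst (ℚ._≤ 4ℚ ℚ.* δ)
    (sym (sum-combination (1ℚ ℚ.- q) (1ℚ ℚ.+ q)
      (λ i → distℚ (p i) c⁻) (λ i → distℚ (p i) c) (λ i → distℚ (p i) c⁺)))
    (gap-small q ε (costℚ p c⁻) (costℚ p c) (costℚ p c⁺)
      (weightedCostℚ ω x c⁻) (weightedCostℚ ω x c) (weightedCostℚ ω x c⁺) δ
      ε≤q (cost≥0 c⁻) (cost≥0 c) (cost≥0 c⁺) (weighted-linear ω x c⁻ c c⁺ lin) h⁻ h⁺ h)
    where
    cost≥0 : ∀ (c : Vector ℚ (suc k)) → 0ℚ ℚ.≤ costℚ p c
    cost≥0 c = sum-nonNeg λ i → distℚ-nonNeg (p i) c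

  t≰4*⅛t : ∀ {t} → 0ℚ ℚ.< t → ¬ t ℚ.≤ 4ℚ ℚ.* (+ 1 ℚ./ 8 ℚ.* t)
  t≰4*⅛t {t} t>0 t≤ = ℚ.<-irrefl refl (ℚ.<-≤-trans t>0 (≤-by (+ 2 ℚ./ 1 ⊙ ⟦ t≤ ⟧)
    (solve 1 (λ t → con 0ℚ := t :+ con (+ 2 ℚ./ 1) :* (con 4ℚ :* (con (+ 1 ℚ./ 8) :* t) :- t))
      refl t)))

  -- Finitely many eventual facts hold together at one index N: ε ≤ q, three coreset inequalities,
  -- and closeness of S to the points it hits. There the total gap is at most 4δ.
  coreset-irrefutable : ∀ {n s k ε q} {p : Vector ℚ n} (p-inj : Injective _≡_ _≡_ p)
    {S : FiniteSubset s} → Eventually (λ m → seq ε m ℚ.≤ q) →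
    (coreset : IsCoreset (suc k) ε (embed p p-inj) S) →
    ¬ Refutation k q p (proj₁ ∘ proj₁ coreset)
  coreset-irrefutable {n} {k = k} {ε} {q} {p} p-inj {S} ε≤q (S⊆P , w , _ , approximates) ref =
    let N , h = ε≤q
              ⊗ (eventually-lower {P = P} S w C⁻ ε δ>0 (proj₁ (approximates C⁻))
              ⊗ (eventually-lower {P = P} S w C⁺ ε δ>0 (proj₁ (approximates C⁺))
              ⊗ (eventually-upper {P = P} S w C ε δ>0 (proj₂ (approximates C))
              ⊗ near)))
        εN≤q , h⁻ , h⁺ , h⁰ , nearN = h N ℕ.≤-refl
    in t≰4*⅛t gap-pos (total-gap-small {q = q} {ε = seq ε N} {δ = δ} p (λ i → seq (w i) N) (λ i → seq (point S i) N) c⁻ c c⁺ εN≤q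
         (λ i → linear i (seq (point S i) N) (nearN i)) h⁻ h⁺ h⁰)
    where
    open Refutation ref
    P : FiniteSubset n
    P = embed p p-inj
    C⁻ C C⁺ : FiniteSubset (suc k)
    C⁻ = embed c⁻ c⁻-injective
    C  = embed c c-injective
    C⁺ = embed c⁺ c⁺-injective
    -- With an eighth of the total gap as slack, 4δ is only half of that gap, a contradiction.
    δ : ℚ
    δ = + 1 ℚ./ 8 ℚ.* Σℚ.sum (gap q c⁻ c c⁺ ∘ p)
    δ>0 : 0ℚ ℚ.< δ
    δ>0 = *-pos (ℚ.positive⁻¹ (+ 1 ℚ./ 8)) gap-pos
    near : Eventually (λ n → ∀ i → ℚ.∣ seq (point S i) n ℚ.- p (proj₁ (S⊆P i)) ∣ ℚ.≤ ¼)
    near = eventually-∀ (λ i → proj₂ (S⊆P i) ¼ (ℚ.positive⁻¹ ¼))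

  -- Take q = ε_M + δ for a late M, with δ half the smaller of the margins η ≤ ε and θ ≤ 1 - ε.
  -- Later terms stay within δ of ε_M, so ε_n ≤ q ≤ ε_n + 2δ ≤ 2ε_n, and q ≤ 1 - θ/2.
  rational-above : ∀ ε → 0ℝ < ε → ε < 1ℝ → ∃[ q ] 0ℚ ℚ.< q × q ℚ.< 1ℚ ×
    Eventually (λ n → seq ε n ℚ.≤ q × q ℚ.≤ seq ε n ℚ.+ seq ε n)
  rational-above ε (η , η>0 , ε≥η) (θ , θ>0 , ε≤1-θ) =
    let N , near = cauchy ε δ δ>0
        -- The trivial first conjunct records that M itself lies in the range where `near` applies.
        M , h = (N , λ n N≤n → N≤n) ⊗ (ε≥η ⊗ ε≤1-θ)
        N≤M , η≤εM , εM≤1-θ = h M ℕ.≤-refl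
        q = seq ε M ℚ.+ δ
    in q
     , ℚ.<-≤-trans δ>0 (≤-by (⟦ η≤εM ⟧ ⊕ ℚ.<⇒≤ η>0)
         (solve 3 (λ e d η → e :+ d := d :+ ((e :- (con 0ℚ :+ η)) :+ η)) refl (seq ε M) δ η))
     , ℚ.≤-<-trans
         (≤-by (⟦ εM≤1-θ ⟧ ⊕ ½ ⊙ ⟦ ℚ.p⊓q≤q η θ ⟧)
           (solve 3 (λ e θ μ → con 1ℚ :- con ½ :* θ :=
             (e :+ con ½ :* μ) :+ ((con 1ℚ :- (e :+ θ)) :+ con ½ :* (θ :- μ)))
             refl (seq ε M) θ (η ℚ.⊓ θ)))
         (<-by (*-pos (ℚ.positive⁻¹ ½) θ>0)
           (solve 1 (λ θ → con 1ℚ := (con 1ℚ :- con ½ :* θ) :+ con ½ :* θ) refl θ))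
     , M , λ n M≤n →
         let N≤n , η≤εn , _ = h n M≤n
             close = near M n N≤M N≤n
         in ≤-by ⟦ ℚ.≤-trans (c-x≤∣x-c∣ (seq ε M) (seq ε n)) close ⟧
              (solve 3 (λ e x d → e :+ d := x :+ (d :- (x :- e))) refl (seq ε M) (seq ε n) δ)
          , ≤-by (⟦ ℚ.≤-trans (x-c≤∣x-c∣ (seq ε M) (seq ε n)) close ⟧
                  ⊕ ⟦ η≤εn ⟧ ⊕ ⟦ ℚ.p⊓q≤p η θ ⟧)
              (solve 4 (λ e x η μ → x :+ x := (e :+ con ½ :* μ) :+
                ((con ½ :* μ :- (e :- x)) :+ ((x :- (con 0ℚ :+ η)) :+ (η :- μ))))
                refl (seq ε M) (seq ε n) η (η ℚ.⊓ θ))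
    where
    δ : ℚ
    δ = ½ ℚ.* (η ℚ.⊓ θ)
    δ>0 : 0ℚ ℚ.< δ
    δ>0 = *-pos (ℚ.positive⁻¹ ½)
      ([ (λ eq → subst (0ℚ ℚ.<_) (sym eq) η>0) , (λ eq → subst (0ℚ ℚ.<_) (sym eq) θ>0) ]′
        (ℚ.⊓-sel η θ))

  -- Size bounds for a rational precision q.

  ι∘toℕ-injective : ∀ {n} → Injective _≡_ _≡_ (ι ∘ toℕ {n})
  ι∘toℕ-injective = Fin.toℕ-injective ∘ ι-injective

  module _ (k u : ℕ) (q : ℚ) (q>0 : 0ℚ ℚ.< q) (q≤½ : q ℚ.≤ ½)
           (32qu≤k : + 32 ℚ./ 1 ℚ.* (q ℚ.* ι u) ℚ.≤ ι (suc k)) where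
    open Geometric (suc k ℕ.+ u)

    geometric-size : ∀ {s ε} {S : FiniteSubset s} →
      Eventually (λ m → seq ε m ℚ.≤ q) → IsCoreset (suc (suc k)) ε (embed p p-injective) S →
      suc u ℕ.≤ s
    geometric-size {s} {ε} {S} ε≤q coreset = ℕ.≰⇒> λ s≤u →
      coreset-irrefutable {k = suc k} {ε} {q} {p} p-injective {S} ε≤q coreset
        (geometric-refutation (suc k) u q q>0 q≤½ (ℕ.s≤s ℕ.z≤n) 32qu≤k (proj₁ ∘ proj₁ coreset) s≤u)

  -- A missed integer would give a refutation, so S hits them all, and choosing a point of S for
  -- each integer is injective.
  integer-size : ∀ k q → q ℚ.< 1ℚ → ∀ {s ε} {S : FiniteSubset s} →
    Eventually (λ m → seq ε m ℚ.≤ q) →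
    IsCoreset (suc k) ε (embed (ι ∘ toℕ {suc k}) ι∘toℕ-injective) S → suc k ℕ.≤ s
  integer-size k q q<1 {s} {ε} {S} ε≤q coreset = Fin.injective⇒≤ section-injective
    where
    f : Fin s → Fin (suc k)
    f = proj₁ ∘ proj₁ coreset
    hit : ∀ i₀ → ∃[ i ] f i ≡ i₀
    hit i₀ with Fin.any? (λ i → f i Fin.≟ i₀)
    ... | yes h = h
    ... | no unhit = contradiction
      (integer-refutation q q<1 f i₀ (λ i eq → unhit (i , eq)))
      (coreset-irrefutable {k = k} {ε} {q} {ι ∘ toℕ} ι∘toℕ-injective {S} ε≤q coreset)
    section-injective : Injective _≡_ _≡_ (proj₁ ∘ hit)
    section-injective {i} {j} eq =
      trans (sym (proj₂ (hit i))) (trans (cong f eq) (proj₂ (hit j)))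

  -- Here k counts the nonzero centers, so 1 + k is the full number. The constant 64 comes from 1 +
  -- k ≤ 2k ≤ 2 · 32qu.
  size-small : ∀ {q k u s} → 0ℚ ℚ.≤ q → 1ℚ ℚ.≤ k → k ℚ.≤ + 32 ℚ./ 1 ℚ.* q ℚ.* u → u ℚ.≤ s →
    1ℚ ℚ.+ k ℚ.≤ + 64 ℚ./ 1 ℚ.* (q ℚ.* s)
  size-small {q} {k} {u} {s} q≥0 1≤k k≤32qu u≤s = ≤-by
    (⟦ 1≤k ⟧ ⊕ + 2 ℚ./ 1 ⊙ ⟦ k≤32qu ⟧ ⊕ + 64 ℚ./ 1 ⊙ *-nonNeg q≥0 ⟦ u≤s ⟧)
    (solve 4 (λ k q u s → con (+ 64 ℚ./ 1) :* (q :* s) := (con 1ℚ :+ k) :+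
        ((k :- con 1ℚ) :+ (con (+ 2 ℚ./ 1) :* (con (+ 32 ℚ./ 1) :* q :* u :- k)
          :+ con (+ 64 ℚ./ 1) :* (q :* (s :- u)))))
      refl k q u s)

  size-large : ∀ {q k s} → ½ ℚ.≤ q → 0ℚ ℚ.≤ s → k ℚ.≤ s → k ℚ.≤ + 64 ℚ./ 1 ℚ.* (q ℚ.* s)
  size-large {q} {k} {s} ½≤q s≥0 k≤s = ≤-by
    (⟦ k≤s ⟧ ⊕ + 64 ℚ./ 1 ⊙ *-nonNeg ⟦ ½≤q ⟧ s≥0 ⊕ + 31 ℚ./ 1 ⊙ s≥0)
    (solve 3 (λ k q s → con (+ 64 ℚ./ 1) :* (q :* s) := k :+ ((s :- k) :+
        (con (+ 64 ℚ./ 1) :* ((q :- con ½) :* s) :+ con (+ 31 ℚ./ 1) :* s)))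
      refl k q s)

  geometric-bound : ∀ k u {q} → 0ℚ ℚ.< q → q ℚ.≤ ½ →
    + 32 ℚ./ 1 ℚ.* q ℚ.* ι u ℚ.≤ ι (suc k) → ι (suc k) ℚ.≤ + 32 ℚ./ 1 ℚ.* q ℚ.* ι (suc u) →
    ForcesSize (suc (suc k)) q
  geometric-bound k u {q} q>0 q≤½ 32qu≤k k≤32q[u+1] =
    count , embed p p-injective , λ s ε S ε≤q coreset →
      subst (ℚ._≤ + 64 ℚ./ 1 ℚ.* (q ℚ.* ι s)) (sym (ι-suc (suc k)))
        (size-small {q} {ι (suc k)} {ι (suc u)} {ι s} (ℚ.<⇒≤ q>0) 1≤k k≤32q[u+1]
          (ι-mono (geometric-size k u q q>0 q≤½ 32qu≤k′ {s} {ε} {S} ε≤q coreset)))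
    where
    open Geometric (suc k ℕ.+ u)
    1≤k : 1ℚ ℚ.≤ ι (suc k)
    1≤k = subst (ℚ._≤ ι (suc k)) ι1≡1 (ι-mono (ℕ.s≤s ℕ.z≤n))
    32qu≤k′ : + 32 ℚ./ 1 ℚ.* (q ℚ.* ι u) ℚ.≤ ι (suc k)
    32qu≤k′ = subst (ℚ._≤ ι (suc k)) (ℚ.*-assoc (+ 32 ℚ./ 1) q (ι u)) 32qu≤k

  integer-bound : ∀ k {q} → ½ ℚ.≤ q → q ℚ.< 1ℚ → ForcesSize (suc (suc k)) q
  integer-bound k {q} ½≤q q<1 =
    suc (suc k) , embed (ι ∘ toℕ) ι∘toℕ-injective , λ s ε S ε≤q coreset →
      size-large {q} {ι (suc (suc k))} {ι s} ½≤q (ι-nonNeg s)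
        (ι-mono (integer-size (suc k) q q<1 {s} {ε} {S} ε≤q coreset))

  forcesSize : ∀ k q → 0ℚ ℚ.< q → q ℚ.< 1ℚ → ForcesSize (suc (suc k)) q
  forcesSize k q q>0 q<1 = [ small , (λ ½≤q → integer-bound k ½≤q q<1) ]′ (ℚ.≤-total q ½)
    where
    small : q ℚ.≤ ½ → ForcesSize (suc (suc k)) q
    small q≤½ =
      -- u is (k+1)/(32q) rounded down: the lower estimate permits the refutation for all s ≤ u, the
      -- upper one turns s ≥ u + 1 into the size bound.
      let u , 32qu≤k , k≤32q[u+1] =
            quotient (*-pos (ℚ.positive⁻¹ (+ 32 ℚ./ 1)) q>0) (ι-nonNeg (suc k))
      in geometric-bound k u q>0 q≤½ 32qu≤k k≤32q[u+1]

  -- Once the terms of x exceed the margin η, the clamp in the definition of the reciprocal is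
  -- inactive.
  ⁻¹-seq : ∀ x (x>0 : 0ℝ < x) →
    Eventually (λ n → 0ℚ ℚ.≤ seq (x ⁻¹[ x>0 ]) n × seq x n ℚ.* seq (x ⁻¹[ x>0 ]) n ≡ 1ℚ)
  ⁻¹-seq x (η , η>0 , N , h) = N , λ n N≤n →
    let z = seq x n ℚ.⊔ η
        z>0 = ℚ.<-≤-trans η>0 (ℚ.p≤q⊔p (seq x n) η)
        z≡x = ℚ.p≥q⇒p⊔q≡p (subst (ℚ._≤ seq x n) (ℚ.+-identityˡ η) (h n N≤n))
    in ℚ.<⇒≤ (ℚ.positive⁻¹ ((ℚ.1/ z) {{ℚ.>-nonZero z>0}}) {{ℚ.1/pos⇒pos z {{ℚ.positive z>0}}}})
     , trans (cong (ℚ._* (ℚ.1/ z) {{ℚ.>-nonZero z>0}}) (sym z≡x))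
         (ℚ.*-inverseʳ z {{ℚ.>-nonZero z>0}})

  -- r stands for 1/ε. The constant 128 is the 64 of `ForcesSize` times the factor 2 lost in q ≤ 2ε:
  -- kr/128 ≤ qsr/2 ≤ εrs = s.
  final-bound : ∀ {k q s ε r δ} → 0ℚ ℚ.≤ r → ε ℚ.* r ≡ 1ℚ → 0ℚ ℚ.≤ s → 0ℚ ℚ.≤ δ →
    k ℚ.≤ + 64 ℚ./ 1 ℚ.* (q ℚ.* s) → q ℚ.≤ ε ℚ.+ ε →
    + 1 ℚ./ 128 ℚ.* k ℚ.* r ℚ.≤ s ℚ.+ δ
  final-bound {k} {q} {s} {ε} {r} {δ} r≥0 εr≡1 s≥0 δ≥0 k≤ q≤ = ≤-by
    (+ 1 ℚ./ 128 ⊙ *-nonNeg r≥0 ⟦ k≤ ⟧ ⊕ ½ ⊙ *-nonNeg r≥0 (*-nonNeg s≥0 ⟦ q≤ ⟧)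
      ⊕ *-nonNeg s≥0 ⟦ ℚ.≤-reflexive εr≡1 ⟧ ⊕ δ≥0)
    (solve 6 (λ k q s e r d → s :+ d := con (+ 1 ℚ./ 128) :* k :* r :+
        (con (+ 1 ℚ./ 128) :* (r :* (con (+ 64 ℚ./ 1) :* (q :* s) :- k)) :+
        (con ½ :* (r :* (s :* ((e :+ e) :- q))) :+ (s :* (con 1ℚ :- e :* r) :+ d))))
      refl k q s ε r δ)

-- Transfer from the rational q to the real ε.

theorem2p9 : ∃[ c₀ ] 0ℝ < c₀ ×
    (∀ (k : ℕ) → 2 ℕ.≤ k →
    ∀ (ε : ℝ) (ε>0 : 0ℝ < ε) → ε < 1ℝ →
    ∃[ n ] Σ[ P ∈ FiniteSubset n ]
    (∀ (s : ℕ) (S : FiniteSubset s) → IsCoreset k ε P S →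
    c₀ * fromℕ k * (ε ⁻¹[ ε>0 ]) ≤ fromℕ s))
theorem2p9 = fromℚ c₀ , (c₀ , ℚ.positive⁻¹ c₀ , 0 , λ _ _ → ℚ.≤-reflexive (ℚ.+-identityˡ c₀)) , main
  where
  c₀ : ℚ
  c₀ = + 1 ℚ./ 128
  main : ∀ k → 2 ℕ.≤ k → ∀ ε (ε>0 : 0ℝ < ε) → ε < 1ℝ →
    ∃[ n ] Σ[ P ∈ FiniteSubset n ]
      (∀ s (S : FiniteSubset s) → IsCoreset k ε P S →
        fromℚ c₀ * fromℕ k * (ε ⁻¹[ ε>0 ]) ≤ fromℕ s)
  main (suc (suc k)) (ℕ.s≤s (ℕ.s≤s ℕ.z≤n)) ε ε>0 ε<1 =
    let q , q>0 , q<1 , N , q-approx = rational-above ε ε>0 ε<1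
        n , P , size = forcesSize k q q>0 q<1
    in n , P , λ s S coreset δ δ>0 →
      let k≤64qs = size s ε S (N , λ m N≤m → proj₁ (q-approx m N≤m)) coreset
          M , h = (N , q-approx) ⊗ ⁻¹-seq ε ε>0
      in M , λ m M≤m →
        let (_ , q≤2ε) , r≥0 , εr≡1 = h m M≤m
        -- `fromℕ` is built from literal fractions, which `ι≡/1` identifies with the opaque `ι`.
        in subst₂ (λ a b → c₀ ℚ.* a ℚ.* seq (ε ⁻¹[ ε>0 ]) m ℚ.≤ b ℚ.+ δ)
             (ι≡/1 (suc (suc k))) (ι≡/1 s)
             (final-bound {ε = seq ε m} r≥0 εr≡1 (ι-nonNeg s) (ℚ.<⇒≤ δ>0) k≤64qs q≤2ε)
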